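{- Let $\varepsilon > 0$ and an integer $k \geq 2$ be fixed, and let $C$ be an orientation of a $k$-cycle. Then there exists a constant $c \geq 1$ such that every digraph $D$ without loops or parallel arcs with $\chi(D) \geq c$ and minimum out-degree at least $\varepsilon|V(D)|$ contains $C$ as a subdigraph, if and only if $C$ either consists of at least three blocks or consists of exactly two blocks, both of length at least two.
   Context: Digraphs have no loops and no parallel arcs, but anti-parallel arcs (directed 2-cycles) are allowed. An orientation of an undirected graph $G$ is a digraph on $V(G)$ containing, for each edge $uv\in E(G)$, exactly one of the arcs $uv$, $vu$. The chromatic number $\chi(D)$ of a digraph is the chromatic number of its underlying undirected graph. Subdigraphs need not be induced. A block of an orientation $C$ of a cycle is a maximal connected subdigraph of $C$ that contains neither the oriented path $x\rightarrow y\leftarrow z$ nor the oriented path $x\leftarrow y\rightarrow z$ as a subdigraph (so a directed cycle has one block, and otherwise the blocks are the maximal directed subpaths). The length of a block $B$ is $|E(B)|$.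
   Formalization: "For every ε > 0" is placed inside the left side of the equivalence instead of fixing ε first: for fixed large ε (e.g. ε = 1) the condition on D is unsatisfiable, so the claim fails for a directed triangle. ε ranges over positive rationals, which is equivalent. -}

module Defs where

open import Data.Nat using (ℕ; zero; suc; _+_; _*_; _∸_; _≤_; _<_; s≤s; z≤n)
open import Data.Nat.DivMod using (_mod_)
open import Data.Fin using (Fin; toℕ)
open import Data.Bool using (Bool; true; false; if_then_else_)
open import Data.List using (List; map; allFin)
open import Data.Nat.ListAction using (sum)
open import Data.Product using (Σ; _×_; _,_; ∃; ∃-syntax)
open import Data.Integer using (+_)
open import Data.Rational using (ℚ) renaming (_/_ to _/ℚ_; _*_ to _*ℚ_; _≤_ to _≤ℚ_)
open import Function.Definitions using (Injective)
open import Relation.Binary.PropositionalEquality using (_≡_; _≢_)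

-- Digraphs: finite vertex set Fin n, arcs given by a Boolean adjacency
-- relation (so no parallel arcs), no loops; anti-parallel arcs allowed.

record Digraph : Set where
  field
    n        : ℕ
    arc      : Fin n → Fin n → Bool
    loopless : ∀ v → arc v v ≡ false

open Digraph public

∣V∣ : Digraph → ℕ
∣V∣ D = n D

outdeg : (D : Digraph) → Fin (n D) → ℕ
outdeg D u = sum (map (λ v → if arc D u v then 1 else 0) (allFin (n D)))

MinOutDegAtLeast : ℚ → Digraph → Set
MinOutDegAtLeast ε D =
  ∀ u → ε *ℚ (+ (∣V∣ D) /ℚ 1) ≤ℚ (+ (outdeg D u) /ℚ 1)

-- proper m-colouring of the underlying undirected graph
-- (adjacent = joined by an arc in either direction; checking every arc suffices)
Colourable : Digraph → ℕ → Set
Colourable D m =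
  Σ (Fin (n D) → Fin m) λ f → ∀ u v → arc D u v ≡ true → f u ≢ f v

ChromaticAtLeast : Digraph → ℕ → Set
ChromaticAtLeast D c = ∀ m → Colourable D m → c ≤ m

-- Orientations of the k-cycle (k ≥ 2).
-- The k-cycle has vertices Fin k and edges e_i = {i, i+1 mod k}, i ∈ Fin k.
-- An orientation is dir : Fin k → Bool; dir i = true means the arc
-- i → i+1, dir i = false means the arc i+1 → i.

cyc : ∀ {k} → 2 ≤ k → ℕ → Fin k
cyc {suc (suc m)} (s≤s (s≤s _)) j = j mod (suc (suc m))

dirAt : ∀ {k} → 2 ≤ k → (Fin k → Bool) → ℕ → Bool
dirAt h dir j = dir (cyc h j)

tailC : ∀ {k} → 2 ≤ k → (Fin k → Bool) → Fin k → Fin k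
tailC h dir i = if dir i then cyc h (toℕ i) else cyc h (suc (toℕ i))

headC : ∀ {k} → 2 ≤ k → (Fin k → Bool) → Fin k → Fin k
headC h dir i = if dir i then cyc h (suc (toℕ i)) else cyc h (toℕ i)

-- the orientation is a digraph: no two edges give the same (parallel) arc
-- (only restrictive for k = 2, where it forces the directed 2-cycle)
NoParallelArcs : ∀ {k} → 2 ≤ k → (Fin k → Bool) → Set
NoParallelArcs h dir =
  ∀ i j → tailC h dir i ≡ tailC h dir j → headC h dir i ≡ headC h dir j → i ≡ j

Contains : (D : Digraph) → ∀ {k} → 2 ≤ k → (Fin k → Bool) → Set
Contains D {k} h dir =
  Σ (Fin k → Fin (n D)) λ f → Injective _≡_ _≡_ f ×
    (∀ i → arc D (f (tailC h dir i)) (f (headC h dir i)) ≡ true)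

-- Blocks.
-- Edge e_s starts a block iff its direction differs from that of the
-- preceding edge e_{s-1}; when there is no such edge C is a directed
-- cycle and has exactly one block.

BlockStart : ∀ {k} → 2 ≤ k → (Fin k → Bool) → Fin k → Set
BlockStart {k} h dir s = dirAt h dir (toℕ s + (k ∸ 1)) ≢ dirAt h dir (toℕ s)

xor : Bool → Bool → Bool
xor true  b = if b then false else true
xor false b = b

numStarts : ∀ {k} → 2 ≤ k → (Fin k → Bool) → ℕ
numStarts {k} h dir =
  sum (map (λ s → if xor (dirAt h dir (toℕ s + (k ∸ 1))) (dirAt h dir (toℕ s))
                  then 1 else 0)
           (allFin k))

numBlocks : ∀ {k} → 2 ≤ k → (Fin k → Bool) → ℕ
numBlocks h dir with numStarts h dir
... | zero  = 1
... | suc m = suc m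

BlockOfLength : ∀ {k} → 2 ≤ k → (Fin k → Bool) → Fin k → ℕ → Set
BlockOfLength h dir s L =
  BlockStart h dir s × 1 ≤ L ×
  (∀ j → j < L → dirAt h dir (toℕ s + j) ≡ dirAt h dir (toℕ s)) ×
  dirAt h dir (toℕ s + L) ≢ dirAt h dir (toℕ s)

{-# OPTIONS --safe #-}
module Submission where

-- Sufficiency. Let every out-degree be at least n / q. A greedy argument (Cover) colours the vertices by a bounded number
-- of centres: if every remaining x has a centre c with T x ∩ S c of positive density, a bounded number of centres
-- serves all x with positive density. A class of large chromatic number contains every oriented path, and
-- positive density leaves room to pick vertices off a given path.
-- * Two long blocks: some sink of C ends two directed 2-paths u → ω → t ← ω' ← v. The centres are vertices t, with
--   S t the in-neighbourhood of t and T x the out-neighbourhood of x, and the rest of C is a path in the class of t.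
-- * At least four blocks: remove two sinks, leaving oriented paths P and Q. The centres are copies of P, with S P the
--   product of the out-neighbourhoods of its two ends and T x the square of the out-neighbourhood of x; Q lies in
--   the class of P, and its ends are joined to those of P by common out-neighbours. To find a copy of P whose ends
--   both share out-neighbours with one x, apply the greedy argument first with vertices as centres.
--
-- Necessity. Shift graphs on increasing tuples have unbounded chromatic number and are acyclic. Let the tuple x point to
-- the bit vectors ω with ω (first x) = 0 and ω (last x) = 1, a quarter of them, and put these bit vectors at the
-- start of a long directed cycle of complete layers. If the shift path from x to y makes the last entry of x the
-- first entry of y, then x and y have disjoint sets of bit vectors, so an arc is never the chord of a directed path
-- of the given length; and there is no directed cycle of length k.

open import Defs
open import Data.Bool using (Bool; true; false; if_then_else_; _∧_; _∨_; not; T)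
import Data.Bool.Properties as Bool
open import Data.Empty using (⊥; ⊥-elim)
open import Data.Fin as Fin using (Fin; toℕ; inject≤; _↑ˡ_; _↑ʳ_; funToFin; finToFun)
import Data.Fin.Properties as Fin
import Data.Integer as ℤ
import Data.Integer.Properties as ℤ
open import Data.List using (List; []; _∷_; map; allFin; length; _++_; filter; cartesianProduct; cartesianProductWith; upTo; concat; replicate; lookup)
open import Data.List.Membership.Propositional using (_∈_; _∉_)
open import Data.List.Membership.Propositional.Properties using (∈-allFin; ∈-++⁺ˡ; ∈-++⁺ʳ; ∈-++⁻; ∈-map⁺; ∈-filter⁺; ∈-upTo⁺; ∈-cartesianProductWith⁺)
open import Data.List.Properties using (length-++; length-map; length-tabulate; length-upTo; map-++; map-∘; map-tabulate; tabulate-lookup; ++-assoc; ++-identityʳ)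
open import Data.List.Relation.Binary.Disjoint.Propositional using (Disjoint)
open import Data.List.Relation.Unary.All as All using (All; []; _∷_)
open import Data.List.Relation.Unary.AllPairs using ([]; _∷_)
open import Data.List.Relation.Unary.Any using (here; there; index)
open import Data.List.Relation.Unary.Any.Properties using (lookup-index)
open import Data.List.Relation.Unary.Unique.Propositional using (Unique)
import Data.List.Relation.Unary.Unique.Propositional.Properties as Unique
open import Data.Nat using (ℕ; zero; suc; pred; _+_; _*_; _∸_; _^_; _≤_; _<_; s≤s; z≤n; _<?_; _≤?_; _≡ᵇ_; NonZero; >-nonZero)
open import Data.Nat.DivMod using (_%_; m%n<n; m%n≤m; m<n⇒m%n≡m; [m+n]%n≡m%n; [m+kn]%n≡m%n; %-distribˡ-+; m%n%n≡m%n; n%n≡0)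
open import Data.Nat.ListAction using (sum)
open import Data.Nat.ListAction.Properties using (sum-++)
open import Data.Nat.Properties
open import Data.Nat.Tactic.RingSolver using (solve-∀)
open import Data.Product using (Σ; ∃; _×_; _,_; proj₁; proj₂)
open import Data.Rational as ℚ using (ℚ; mkℚ; 0ℚ; toℚᵘ)
import Data.Rational.Properties as ℚ
open import Data.Rational.Unnormalised as ℚᵘ using (mkℚᵘ)
import Data.Rational.Unnormalised.Properties as ℚᵘ
open import Data.Sum as Sum using (_⊎_; inj₁; inj₂)
open import Data.Sum.Properties using (inj₁-injective; inj₂-injective)
open import Data.Unit using (⊤; tt)
open import Data.Vec as Vec using (Vec; []; _∷_; head; tail; _∷ʳ_)
import Data.Vec.Properties as Vec
open import Function using (_∘_; id; flip)
open import Function.Bundles using (_⇔_; mk⇔)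
open import Relation.Binary.Definitions using (tri<; tri≈; tri>)
open import Relation.Binary.PropositionalEquality hiding (J)
open import Relation.Nullary using (¬_; Dec; yes; no; does; contradiction)
open import Relation.Nullary.Decidable using (_×-dec_)

-- Counting

⟦_⟧ : Bool → ℕ
⟦ b ⟧ = if b then 1 else 0

∑ : {A : Set} → List A → (A → ℕ) → ℕ
∑ xs f = sum (map f xs)

count : {A : Set} → (A → Bool) → List A → ℕ
count P xs = ∑ xs (λ x → ⟦ P x ⟧)

∧-true : ∀ {a b} → a ∧ b ≡ true → a ≡ true × b ≡ true
∧-true {true} {true} _ = refl , refl

∧-intro : ∀ {a b} → a ≡ true → b ≡ true → a ∧ b ≡ true
∧-intro refl refl = refl

bool-split : (b : Bool) → b ≡ true ⊎ b ≡ false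
bool-split true  = inj₁ refl
bool-split false = inj₂ refl

true≢false : ∀ {b} → b ≡ true → b ≡ false → ⊥
true≢false refl ()

module _ {A : Set} where

  ∑-mono : (xs : List A) {f g : A → ℕ} → (∀ x → f x ≤ g x) → ∑ xs f ≤ ∑ xs g
  ∑-mono []       h = z≤n
  ∑-mono (x ∷ xs) h = +-mono-≤ (h x) (∑-mono xs h)

  ∑-cong : (xs : List A) {f g : A → ℕ} → (∀ x → f x ≡ g x) → ∑ xs f ≡ ∑ xs g
  ∑-cong []       h = refl
  ∑-cong (x ∷ xs) h = cong₂ _+_ (h x) (∑-cong xs h)

  ∑-+ : (xs : List A) (f g : A → ℕ) → ∑ xs (λ x → f x + g x) ≡ ∑ xs f + ∑ xs g
  ∑-+ []       f g = refl
  ∑-+ (x ∷ xs) f g = trans (cong (f x + g x +_) (∑-+ xs f g)) (lem (f x) (g x) (∑ xs f) (∑ xs g))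
    where
    lem : ∀ a b c d → a + b + (c + d) ≡ a + c + (b + d)
    lem = solve-∀

  ∑-*ˡ : (c : ℕ) (xs : List A) (f : A → ℕ) → ∑ xs (λ x → c * f x) ≡ c * ∑ xs f
  ∑-*ˡ c []       f = sym (*-zeroʳ c)
  ∑-*ˡ c (x ∷ xs) f = trans (cong (c * f x +_) (∑-*ˡ c xs f)) (sym (*-distribˡ-+ c (f x) (∑ xs f)))

  ∑-const : (c : ℕ) (xs : List A) → ∑ xs (λ _ → c) ≡ length xs * c
  ∑-const c []       = refl
  ∑-const c (x ∷ xs) = cong (c +_) (∑-const c xs)

  -- This serves for averaging: one good element is extracted from a comparison of totals.
  ∑-< : (xs : List A) (f g : A → ℕ) → ∑ xs f < ∑ xs g → ∃ λ x → f x < g x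
  ∑-< (x ∷ xs) f g h with f x <? g x
  ... | yes p = x , p
  ... | no ¬p = ∑-< xs f g (+-cancelˡ-< (g x) _ _ (≤-<-trans (+-monoˡ-≤ (∑ xs f) (≮⇒≥ ¬p)) h))

  count-mono : (xs : List A) {P Q : A → Bool} → (∀ x → P x ≡ true → Q x ≡ true) → count P xs ≤ count Q xs
  count-mono xs {P} {Q} h = ∑-mono xs (λ x → le (P x) (Q x) (h x))
    where
    le : ∀ a b → (a ≡ true → b ≡ true) → ⟦ a ⟧ ≤ ⟦ b ⟧
    le false b h = z≤n
    le true  b h rewrite h refl = ≤-refl

  count≤length : (P : A → Bool) (xs : List A) → count P xs ≤ length xs
  count≤length P []       = z≤n
  count≤length P (x ∷ xs) with P x
  ... | true  = s≤s (count≤length P xs)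
  ... | false = m≤n⇒m≤1+n (count≤length P xs)

  count-split : (P Q : A → Bool) (xs : List A) →
    count P xs ≡ count (λ x → P x ∧ Q x) xs + count (λ x → P x ∧ not (Q x)) xs
  count-split P Q xs =
    trans (∑-cong xs (λ x → eq (P x) (Q x))) (∑-+ xs _ _)
    where
    eq : ∀ a b → ⟦ a ⟧ ≡ ⟦ a ∧ b ⟧ + ⟦ a ∧ not b ⟧
    eq false b     = refl
    eq true  true  = refl
    eq true  false = refl

  count-pos : (P : A → Bool) (xs : List A) → 1 ≤ count P xs → ∃ λ x → P x ≡ true
  count-pos P (x ∷ xs) h with P x in eq
  ... | true  = x , eq
  ... | false = count-pos P xs h

  count-zero : (P : A → Bool) (xs : List A) {x : A} → count P xs ≡ 0 → x ∈ xs → P x ≡ false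
  count-zero P (y ∷ xs) h (here refl) with P y
  ... | false = refl
  count-zero P (y ∷ xs) h (there i) with P y
  ... | false = count-zero P xs h i

  count-++ : (P : A → Bool) (xs ys : List A) → count P (xs ++ ys) ≡ count P xs + count P ys
  count-++ P xs ys = trans (cong sum (map-++ _ xs ys)) (sum-++ (map _ xs) (map _ ys))

∑-swap : {A B : Set} (xs : List A) (ys : List B) (f : A → B → ℕ) →
  ∑ xs (λ x → ∑ ys (f x)) ≡ ∑ ys (λ y → ∑ xs (λ x → f x y))
∑-swap []       ys f = sym (trans (∑-const 0 ys) (*-zeroʳ (length ys)))
∑-swap (x ∷ xs) ys f = trans (cong (∑ ys (f x) +_) (∑-swap xs ys f)) (sym (∑-+ ys (f x) _))

count-map : {A B : Set} (P : B → Bool) (g : A → B) (xs : List A) → count P (map g xs) ≡ count (P ∘ g) xs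
count-map P g xs = cong sum (sym (map-∘ {g = λ x → ⟦ P x ⟧} {f = g} xs))

module _ {n : ℕ} where

  infixl 6 _∖_ _∖∖_

  _∖_ : (Fin n → Bool) → Fin n → Fin n → Bool
  (X ∖ v) u = X u ∧ not (does (u Fin.≟ v))

  _∖∖_ : (Fin n → Bool) → List (Fin n) → Fin n → Bool
  X ∖∖ []       = X
  X ∖∖ (v ∷ vs) = (X ∖ v) ∖∖ vs

  ∖-elim : (X : Fin n → Bool) {v u : Fin n} → (X ∖ v) u ≡ true → X u ≡ true × u ≢ v
  ∖-elim X {v} {u} h with u Fin.≟ v | ∧-true {X u} h
  ... | no u≢v | p , _ = p , u≢v

  ∖-intro : (X : Fin n → Bool) {v u : Fin n} → X u ≡ true → u ≢ v → (X ∖ v) u ≡ true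
  ∖-intro X {v} {u} h u≢v with u Fin.≟ v
  ... | yes u≡v = contradiction u≡v u≢v
  ... | no _    = ∧-intro h refl

  ∖∖-elim : (X : Fin n → Bool) (vs : List (Fin n)) {u : Fin n} → (X ∖∖ vs) u ≡ true → X u ≡ true × u ∉ vs
  ∖∖-elim X []       h = h , λ ()
  ∖∖-elim X (v ∷ vs) h with ∖∖-elim (X ∖ v) vs h
  ... | p , u∉vs with ∖-elim X p
  ... | q , u≢v = q , λ { (here e) → u≢v e ; (there i) → u∉vs i }

  count-∖-unique : (X : Fin n → Bool) (v : Fin n) (xs : List (Fin n)) → Unique xs →
    count X xs ≤ suc (count (X ∖ v) xs)
  count-∖-unique X v []       [] = z≤n
  count-∖-unique X v (x ∷ xs) (x∉ ∷ u) with x Fin.≟ v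
  ... | yes refl = ≤-trans (+-mono-≤ (le (X x)) (same xs x∉)) (s≤s (m≤n+m _ ⟦ X x ∧ false ⟧))
    where
    le : ∀ b → ⟦ b ⟧ ≤ 1
    le true  = ≤-refl
    le false = z≤n
    same : ∀ ys → All (λ y → x ≢ y) ys → count X ys ≤ count (X ∖ x) ys
    same []       []       = z≤n
    same (y ∷ ys) (p ∷ ps) with y Fin.≟ x
    ... | yes e = contradiction (sym e) p
    ... | no _  with X y
    ...   | true  = s≤s (same ys ps)
    ...   | false = same ys ps
  ... | no _ with X x
  ...   | true  = s≤s (count-∖-unique X v xs u)
  ...   | false = count-∖-unique X v xs u

  count-∖-< : (X : Fin n → Bool) (v : Fin n) (xs : List (Fin n)) → v ∈ xs → X v ≡ true →
    count (X ∖ v) xs < count X xs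
  count-∖-< X v (x ∷ xs) (here refl) Xv with v Fin.≟ v
  ... | no ¬p = contradiction refl ¬p
  ... | yes _ rewrite Xv = s≤s (count-mono xs (λ u p → proj₁ (∖-elim X p)))
  count-∖-< X v (x ∷ xs) (there i) Xv with x Fin.≟ v | X x
  ... | yes _ | true  = m≤n⇒m≤1+n (count-∖-< X v xs i Xv)
  ... | yes _ | false = count-∖-< X v xs i Xv
  ... | no _  | true  = s≤s (count-∖-< X v xs i Xv)
  ... | no _  | false = count-∖-< X v xs i Xv

  -- Each deleted vertex occurs once in `allFin n`, so it lowers the count by at most one. Linking
  -- vertices off a given path are chosen in this way.
  fresh : (X : Fin n → Bool) (avoid : List (Fin n)) → length avoid < count X (allFin n) →
    ∃ λ v → X v ≡ true × v ∉ avoid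
  fresh X avoid h = let v , p = count-pos _ (allFin n) (go X avoid h) in v , ∖∖-elim X avoid p
    where
    go : (X : Fin n → Bool) (vs : List (Fin n)) → length vs < count X (allFin n) →
      1 ≤ count (X ∖∖ vs) (allFin n)
    go X []       h = h
    go X (v ∷ vs) h = go (X ∖ v) vs (≤-pred (≤-trans h (count-∖-unique X v (allFin n) (Unique.allFin⁺ n))))

  Unique-count : (X : Fin n → Bool) (vs : List (Fin n)) → Unique vs → All (λ v → X v ≡ true) vs →
    length vs ≤ count X (allFin n)
  Unique-count X []       []       []       = z≤n
  Unique-count X (v ∷ vs) (v∉ ∷ u) (p ∷ ps) =
    ≤-<-trans (Unique-count (X ∖ v) vs u (All.zipWith (λ (q , r) → ∖-intro X q (r ∘ sym)) (ps , v∉)))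
              (count-∖-< X v (allFin n) (∈-allFin v) p)

length-allFin : ∀ n → length (allFin n) ≡ n
length-allFin n = length-tabulate id

count-all : ∀ {A : Set} (xs : List A) → count (λ _ → true) xs ≡ length xs
count-all xs = trans (∑-const 1 xs) (*-identityʳ _)

-- Colourings and oriented paths

module _ {n : ℕ} where

  -- The colouring is total, so a change of `X` affects only the condition on arcs and not the type
  -- of the function.
  Col : (R : Fin n → Fin n → Bool) → (Fin n → Bool) → ℕ → Set
  Col R X m = Σ (Fin n → Fin m) λ f →
    ∀ u v → X u ≡ true → X v ≡ true → R u v ≡ true → f u ≢ f v

  Col-mono : ∀ {R X m m'} → m ≤ m' → Col R X m → Col R X m'
  Col-mono le (f , c) = (λ u → inject≤ (f u) le) ,
    λ u v p q r e → c u v p q r (Fin.inject≤-injective le le _ _ e)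

  Col-flip : ∀ {R X m} → Col (flip R) X m → Col R X m
  Col-flip (f , c) = f , λ u v p q r → c v u q p r ∘ sym

  Col-∅ : ∀ {R X} → (∀ u → X u ≡ false) → Col R X 1
  Col-∅ e = (λ _ → Fin.zero) , λ u _ p → ⊥-elim (true≢false p (e u))

  -- The palettes are disjoint: vertices of `X` use the first one, all others the second.
  Col-∪ : ∀ {R} (X : Fin n → Bool) {Y Z m₁ m₂} →
    (∀ u → Z u ≡ true → X u ≡ false → Y u ≡ true) →
    Col R X m₁ → Col R Y m₂ → Col R Z (m₁ + m₂)
  Col-∪ {R} X {Y} {Z} {m₁} {m₂} s (f , c) (g , d) = (λ u → h u (X u)) , prf
    where
    h : Fin n → Bool → Fin (m₁ + m₂)
    h u true  = f u ↑ˡ m₂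
    h u false = m₁ ↑ʳ g u

    prf : ∀ u v → Z u ≡ true → Z v ≡ true → R u v ≡ true → h u (X u) ≢ h v (X v)
    prf u v p q r with X u in eu | X v in ev
    ... | true  | true  = λ e → c u v eu ev r (Fin.↑ˡ-injective m₂ _ _ e)
    ... | false | false = λ e → d u v (s u p eu) (s v q ev) r (Fin.↑ʳ-injective m₁ _ _ e)
    ... | true  | false = λ e → case (trans (sym (Fin.splitAt-↑ˡ m₁ (f u) m₂))
                                      (trans (cong (Fin.splitAt m₁) e) (Fin.splitAt-↑ʳ m₁ m₂ (g v))))
      where
      case : inj₁ (f u) ≡ inj₂ (g v) → ⊥
      case ()
    ... | false | true  = λ e → case (trans (sym (Fin.splitAt-↑ʳ m₁ m₂ (g u)))
                                      (trans (cong (Fin.splitAt m₁) e) (Fin.splitAt-↑ˡ m₁ (f v) m₂)))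
      where
      case : inj₂ (g u) ≡ inj₁ (f v) → ⊥
      case ()

module _ {n : ℕ} (R : Fin n → Fin n → Bool) (irr : ∀ v → R v v ≡ false) where

  Col-singleton : ∀ {X} v → (∀ u → X u ≡ true → u ≡ v) → Col R X 1
  Col-singleton v s = (λ _ → Fin.zero) , λ u w p q r _ →
    true≢false (trans (cong₂ R (sym (s u p)) (sym (s w q))) r) (irr v)

  Col-∖ : ∀ {X m} v → Col R (X ∖ v) m → Col R X (suc m)
  Col-∖ {X} v c = Col-∪ (λ u → does (u Fin.≟ v)) (λ u p q → ∖-intro X p (λ e → ne u q e))
    (Col-singleton v (λ u p → eq u p)) c
    where
    ne : ∀ u → does (u Fin.≟ v) ≡ false → u ≢ v
    ne u q with u Fin.≟ v
    ... | no ¬e = ¬e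
    eq : ∀ u → does (u Fin.≟ v) ≡ true → u ≡ v
    eq u q with u Fin.≟ v
    ... | yes e = e

  -- Each deleted vertex gets a colour of its own, which is proper because there are no loops.
  Col-∖∖ : ∀ X vs {m} → Col R (X ∖∖ vs) m → Col R X (length vs + m)
  Col-∖∖ X []       c = c
  Col-∖∖ X (v ∷ vs) c = Col-∖ v (Col-∖∖ (X ∖ v) vs c)

nbrs : ∀ {n} → (Fin n → Bool) → List (Fin n)
nbrs {n} P = filter (λ u → P u Bool.≟ true) (allFin n)

length-nbrs : ∀ {n} (P : Fin n → Bool) → length (nbrs P) ≡ count P (allFin n)
length-nbrs {n} P = go (allFin n)
  where
  go : ∀ xs → length (filter (λ u → P u Bool.≟ true) xs) ≡ count P xs
  go []       = refl
  go (x ∷ xs) with P x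
  ... | true  = cong suc (go xs)
  ... | false = go xs

∈-nbrs : ∀ {n} (P : Fin n → Bool) u → P u ≡ true → u ∈ nbrs P
∈-nbrs P u p = ∈-filter⁺ (λ u → P u Bool.≟ true) (∈-allFin u) p

freshColour : ∀ m (cs : List (Fin m)) → length cs < m → ∃ λ c → c ∉ cs
freshColour m cs h =
  let c , _ , c∉ = fresh (λ _ → true) cs (subst (length cs <_) (sym (trans (count-all (allFin m)) (length-allFin m))) h)
  in c , c∉

-- Colouring degenerate digraphs.

module Degenerate {n : ℕ} (R : Fin n → Fin n → Bool) (irr : ∀ v → R v v ≡ false) (d : ℕ) where

  V : List (Fin n)
  V = allFin n

  -- Double counting of the arcs inside `Y`: in-degrees and out-degrees have the same sum, which is
  -- at most `d` times the size of `Y`.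
  lowInDegree : (Y : Fin n → Bool) → (∀ y → Y y ≡ true → count (λ u → Y u ∧ R y u) V ≤ d) →
    1 ≤ count Y V → ∃ λ y → Y y ≡ true × count (λ u → Y u ∧ R u y) V ≤ d
  lowInDegree Y h ne = let y , p = ∑-< V inY lim lt in y , res y p
    where
    inY outY lim : Fin n → ℕ
    inY  y = count (λ u → Y y ∧ (Y u ∧ R u y)) V
    outY y = count (λ u → Y u ∧ (Y y ∧ R y u)) V
    -- This is zero outside `Y`, so an in-degree below `lim` can occur only at a vertex of `Y`.
    lim  y = suc d * ⟦ Y y ⟧

    outY≤ : ∀ y → outY y ≤ d * ⟦ Y y ⟧
    outY≤ y with Y y in eq
    ... | true  = ≤-trans (h y eq) (≤-reflexive (sym (*-identityʳ d)))
    ... | false = ≤-reflexive (trans (∑-cong V (λ u → cong ⟦_⟧ (Bool.∧-zeroʳ (Y u))))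
                    (trans (∑-const 0 V) (trans (*-zeroʳ (length V)) (sym (*-zeroʳ d)))))

    in≡out : ∑ V inY ≡ ∑ V outY
    in≡out = ∑-swap V V (λ y u → ⟦ Y y ∧ (Y u ∧ R u y) ⟧)

    lt : ∑ V inY < ∑ V lim
    lt = begin-strict
      ∑ V inY                        ≡⟨ in≡out ⟩
      ∑ V outY                       ≤⟨ ∑-mono V outY≤ ⟩
      ∑ V (λ y → d * ⟦ Y y ⟧)        ≡⟨ ∑-*ˡ d V (λ y → ⟦ Y y ⟧) ⟩
      d * count Y V                  <⟨ m<n+m (d * count Y V) ne ⟩
      suc d * count Y V              ≡⟨ ∑-*ˡ (suc d) V (λ y → ⟦ Y y ⟧) ⟨
      ∑ V lim                        ∎
      where open ≤-Reasoning

    res : ∀ y → inY y < lim y → Y y ≡ true × count (λ u → Y u ∧ R u y) V ≤ d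
    res y p with Y y
    ... | true  = refl , ≤-pred (≤-trans p (≤-reflexive (*-identityʳ (suc d))))
    ... | false = ⊥-elim (n≮0 (≤-trans p (≤-reflexive (*-zeroʳ d))))

  -- A vertex of in-degree at most `d` has at most `2d` neighbours in `Y`; once the rest is
  -- coloured, one of `2d + 1` colours is free for it. The induction is on an upper bound for the
  -- size of `Y`.
  degenerate : (Y : Fin n → Bool) → (∀ y → Y y ≡ true → count (λ u → Y u ∧ R y u) V ≤ d) →
    Col R Y (suc (d + d))
  degenerate Y = go (count Y V) Y ≤-refl
    where
    go : ∀ s Y → count Y V ≤ s → (∀ y → Y y ≡ true → count (λ u → Y u ∧ R y u) V ≤ d) →
      Col R Y (suc (d + d))
    go zero Y le h = Col-mono (s≤s z≤n) (Col-∅ (λ u → count-zero Y V (n≤0⇒n≡0 le) (∈-allFin u)))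
    go (suc s) Y le h with 1 ≤? count Y V
    ... | no ¬ne = go s Y (≤-trans (≤-pred (≰⇒> ¬ne)) z≤n) h
    ... | yes ne = g , proper
      where
      picked = lowInDegree Y h ne
      y = proj₁ picked
      Yy = proj₁ (proj₂ picked)

      rest : Col R (Y ∖ y) (suc (d + d))
      rest = go s (Y ∖ y) (≤-pred (≤-trans (count-∖-< Y y V (∈-allFin y) Yy) le))
        (λ z p → ≤-trans (count-mono V (λ u q →
                   let a , b = ∧-true q in ∧-intro (proj₁ (∖-elim Y a)) b))
                 (h z (proj₁ (∖-elim Y p))))
      f = proj₁ rest

      outs ins : Fin n → Bool
      outs u = Y u ∧ R y u
      ins  u = Y u ∧ R u y

      used : List (Fin (suc (d + d)))
      used = map f (nbrs outs ++ nbrs ins)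

      few : length used < suc (d + d)
      few = s≤s (begin
        length used                              ≡⟨ length-map f (nbrs outs ++ nbrs ins) ⟩
        length (nbrs outs ++ nbrs ins)           ≡⟨ length-++ (nbrs outs) ⟩
        length (nbrs outs) + length (nbrs ins)   ≡⟨ cong₂ _+_ (length-nbrs outs) (length-nbrs ins) ⟩
        count outs V + count ins V               ≤⟨ +-mono-≤ (h y Yy) (proj₂ (proj₂ picked)) ⟩
        d + d                                    ∎)
        where
        open ≤-Reasoning

      new = proj₁ (freshColour _ used few)
      new∉ = proj₂ (freshColour _ used few)

      g : Fin n → Fin (suc (d + d))
      g u with u Fin.≟ y
      ... | yes _ = new
      ... | no  _ = f u

      proper : ∀ u v → Y u ≡ true → Y v ≡ true → R u v ≡ true → g u ≢ g v
      proper u v Yu Yv r with u Fin.≟ y | v Fin.≟ y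
      ... | yes refl | yes refl = λ _ → true≢false r (irr y)
      ... | yes refl | no _ = λ e → new∉ (subst (_∈ used) (sym e)
              (∈-map⁺ f (∈-++⁺ˡ (∈-nbrs outs v (∧-intro Yv r)))))
      ... | no _ | yes refl = λ e → new∉ (subst (_∈ used) e
              (∈-map⁺ f (∈-++⁺ʳ (nbrs outs) (∈-nbrs ins u (∧-intro Yu r)))))
      ... | no u≢ | no v≢ = proj₂ rest u v (∖-intro Y Yu u≢) (∖-intro Y Yv v≢) r

open Degenerate using (degenerate) public

-- The recursion follows `findPath`: `2(ℓ + 1) + 1` colours for the degenerate set of path heads,
-- and `pathColours ℓ` for the other vertices.
pathColours : ℕ → ℕ
pathColours zero    = 1
pathColours (suc ℓ) = suc (suc ℓ + suc ℓ) + pathColours ℓ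

module Paths {n : ℕ} (R : Fin n → Fin n → Bool) (irr : ∀ v → R v v ≡ false) where

  Step : Bool → Fin n → Fin n → Bool
  Step true  u v = R u v
  Step false u v = R v u

  IsPath : (ℕ → Bool) → Fin n → List (Fin n) → Set
  IsPath G v []       = ⊤
  IsPath G v (w ∷ ws) = Step (G 0) v w ≡ true × IsPath (G ∘ suc) w ws

  record PathFrom (X : Fin n → Bool) (G : ℕ → Bool) (ℓ : ℕ) (v : Fin n) : Set where
    constructor path
    field
      rest     : List (Fin n)
      isPath   : IsPath G v rest
      distinct : Unique (v ∷ rest)
      within   : All (λ u → X u ≡ true) (v ∷ rest)
      size     : length rest ≡ ℓ

  PathFrom-⊆ : ∀ {X Y G ℓ v} → (∀ u → X u ≡ true → Y u ≡ true) → PathFrom X G ℓ v → PathFrom Y G ℓ v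
  PathFrom-⊆ s (path t p d w z) = path t p d (All.map (s _) w) z

  -- The heads of all the paths found while deleting heads one at a time.
  heads : ∀ {G ℓ m} → (∀ X → (∃ λ v → PathFrom X G ℓ v) ⊎ Col R X m) → ∀ X →
    Σ (Fin n → Bool) λ Y → (∀ v → Y v ≡ true → PathFrom X G ℓ v) × (∀ v → Y v ≡ true → X v ≡ true) ×
      Σ (Fin n → Bool) λ Z → Col R Z m × (∀ v → X v ≡ true → Y v ≡ false → Z v ≡ true)
  heads {G} {ℓ} {m} find X = go (count X (allFin n)) X ≤-refl
    where
    go : ∀ s X → count X (allFin n) ≤ s →
      Σ (Fin n → Bool) λ Y → (∀ v → Y v ≡ true → PathFrom X G ℓ v) × (∀ v → Y v ≡ true → X v ≡ true) ×
      Σ (Fin n → Bool) λ Z → Col R Z m × (∀ v → X v ≡ true → Y v ≡ false → Z v ≡ true)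
    go s X le with find X
    ... | inj₂ c = (λ _ → false) , (λ _ ()) , (λ _ ()) , X , c , λ _ p _ → p
    go zero X le | inj₁ (v , p) with PathFrom.within p
    ... | Xv ∷ _ = ⊥-elim (true≢false Xv (count-zero X (allFin n) (n≤0⇒n≡0 le) (∈-allFin v)))
    go (suc s) X le | inj₁ (v , p) with PathFrom.within p
    ... | Xv ∷ _ with go s (X ∖ v) (≤-pred (≤-trans (count-∖-< X v (allFin n) (∈-allFin v) Xv) le))
    ... | Y , paths , Y⊆ , Z , c , cover = Y' , paths' , Y'⊆ , Z , c , cover'
      where
      Y' : Fin n → Bool
      Y' u with u Fin.≟ v
      ... | yes _ = true
      ... | no _  = Y u
      paths' : ∀ u → Y' u ≡ true → PathFrom X G ℓ u
      paths' u q with u Fin.≟ v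
      ... | yes refl = p
      ... | no _     = PathFrom-⊆ (λ w r → proj₁ (∖-elim X r)) (paths u q)
      Y'⊆ : ∀ u → Y' u ≡ true → X u ≡ true
      Y'⊆ u q with u Fin.≟ v
      ... | yes refl = Xv
      ... | no _     = proj₁ (∖-elim X (Y⊆ u q))
      cover' : ∀ u → X u ≡ true → Y' u ≡ false → Z u ≡ true
      cover' u q r with u Fin.≟ v
      ... | no u≢v = cover u (∖-intro X q u≢v) r

  ∉⇒All : ∀ {u} (vs : List (Fin n)) → u ∉ vs → All (λ v → u ≢ v) vs
  ∉⇒All []       h = []
  ∉⇒All (v ∷ vs) h = (λ e → h (here e)) ∷ ∉⇒All vs (h ∘ there)

  Col-Step : ∀ b {X m} → Col (λ u v → Step b v u) X m → Col R X m
  Col-Step true  c = Col-flip c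
  Col-Step false c = c

  irrStep : ∀ b v → Step b v v ≡ false
  irrStep true  = irr
  irrStep false = irr

  -- Take the heads of paths with `ℓ` edges. A head with more than `ℓ + 1` suitable neighbours among
  -- the heads has one off its own path, which extends the path at the front. If there is no such
  -- head, the heads form a degenerate set, and the other vertices are already coloured.
  findPath : ∀ ℓ G X → (∃ λ v → PathFrom X G ℓ v) ⊎ Col R X (pathColours ℓ)
  findPath zero G X with 1 ≤? count X (allFin n)
  ... | yes ne = let v , p = count-pos X (allFin n) ne in inj₁ (v , path [] tt ([] ∷ []) (p ∷ []) refl)
  ... | no ¬ne = inj₂ (Col-∅ (λ u → count-zero X (allFin n) (n≤0⇒n≡0 (≤-pred (≰⇒> ¬ne))) (∈-allFin u)))
  findPath (suc ℓ) G X with heads (findPath ℓ (G ∘ suc)) X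
  ... | Y , paths , Y⊆ , Z , c , cover with Fin.any? high?
    where
    P : Fin n → Fin n → Bool
    P v u = Y u ∧ Step (G 0) u v
    high? = λ v → (Y v Bool.≟ true) ×-dec (suc ℓ <? count (P v) (allFin n))
  ...   | yes (v , Yv , many) with paths v Yv
  ...     | path t p d w z with fresh _ (v ∷ t) (subst (λ k → suc k < count _ (allFin n)) (sym z) many)
  ...       | u , Pu , u∉ =
    let Yu , s = ∧-true Pu in
    inj₁ (u , path (v ∷ t) (s , p) (∉⇒All (v ∷ t) u∉ ∷ d) (Y⊆ u Yu ∷ w) (cong suc z))
  findPath (suc ℓ) G X | Y , paths , Y⊆ , Z , c , cover | no ¬high =
    inj₂ (Col-∪ Y cover
      -- The bounded degrees count predecessors along the step, so degeneracy is applied to the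
      -- reversed relation.
      (Col-Step (G 0) (degenerate (λ u v → Step (G 0) v u) (irrStep (G 0)) (suc ℓ) Y
        (λ y Yy → ≮⇒≥ (λ lt → ¬high (y , Yy , lt))))) c)

-- Greedy covering

does-yes : {P : Set} (d : Dec P) → P → does d ≡ true
does-yes (yes _) _ = refl
does-yes (no ¬p) p = contradiction p ¬p

does-true : {P : Set} (d : Dec P) → does d ≡ true → P
does-true (yes p) _ = p

does-false : {P : Set} (d : Dec P) → does d ≡ false → ¬ P
does-false (no ¬p) _ = ¬p

not-true : ∀ {b} → not b ≡ true → b ≡ false
not-true {false} _ = refl

abstract

  -- Every new centre adds `N / 2a` points to a union inside `Ω`, so `2a + 1` centres are too many.
  -- A vertex outside the classes meets each centre in at most `N / b` points, and `b = threshold a`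
  -- keeps the sum of `steps a` such losses at most `N / 2a`.
  steps threshold : ℕ → ℕ
  steps a     = suc (2 * a)
  threshold a = 2 * a * steps a

  steps≡ : ∀ a → steps a ≡ suc (2 * a)
  steps≡ a = refl

  threshold≡ : ∀ a → threshold a ≡ 2 * a * steps a
  threshold≡ a = refl

module Cover {n : ℕ} (R : Fin n → Fin n → Bool) {Ω Centre : Set} (ωs : List Ω)
  (T : Fin n → Ω → Bool) (S : Centre → Ω → Bool) (a : ℕ) where

  N J b : ℕ
  N = length ωs
  J = steps a
  b = threshold a

  meet : Fin n → Centre → ℕ
  meet x c = count (λ ω → T x ω ∧ S c ω) ωs

  class : Centre → Fin n → Bool
  class c x = does (N ≤? b * meet x c)

  -- `G` is the structure being sought, and each round may end by producing it. Otherwise `pick`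
  -- colours what remains or supplies a centre that meets `T x` in a proportion `1 / a`, and `split`
  -- colours the class of that centre.
  module _ {G : Set} {m₀ m₁ : ℕ} (N≥1 : 1 ≤ N) (X₀ : Fin n → Bool)
    (pick : ∀ X → (∀ x → X x ≡ true → X₀ x ≡ true) → G ⊎ Col R X m₀ ⊎ (∃ λ x → X x ≡ true × ∃ λ c → N ≤ a * meet x c))
    (split : ∀ c → G ⊎ Col R (class c) m₁) where

    private
      -- Each centre picked outside the previous classes covers at least N / 2a new points of Ω.
      gain : ∀ (t s : Ω → Bool) (B : Ω → Bool) j → j ≤ J →
        N ≤ a * count (λ ω → t ω ∧ s ω) ωs → b * count (λ ω → t ω ∧ B ω) ωs ≤ j * N →
        j * N ≤ 2 * a * count B ωs → suc j * N ≤ 2 * a * count (λ ω → B ω ∨ s ω) ωs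
      gain t s B j j≤J big small inv = begin
        N + j * N                           ≤⟨ +-mono-≤ new inv ⟩
        2 * a * s∖B + 2 * a * count B ωs    ≡⟨ *-distribˡ-+ (2 * a) s∖B (count B ωs) ⟨
        2 * a * (s∖B + count B ωs)          ≤⟨ *-monoʳ-≤ (2 * a) union ⟩
        2 * a * count (λ ω → B ω ∨ s ω) ωs  ∎
        where
        open ≤-Reasoning
        s∖B t∩B t∩s : ℕ
        s∖B = count (λ ω → s ω ∧ not (B ω)) ωs
        t∩B = count (λ ω → t ω ∧ B ω) ωs
        t∩s = count (λ ω → t ω ∧ s ω) ωs

        t∩s≤ : t∩s ≤ t∩B + s∖B
        t∩s≤ = begin
          t∩s                    ≡⟨ count-split (λ ω → t ω ∧ s ω) B ωs ⟩
          count (λ ω → (t ω ∧ s ω) ∧ B ω) ωs + count (λ ω → (t ω ∧ s ω) ∧ not (B ω)) ωs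
            ≤⟨ +-mono-≤ (count-mono ωs (λ ω → f₁ (t ω) (s ω) (B ω))) (count-mono ωs (λ ω → f₂ (t ω) (s ω) (B ω))) ⟩
          t∩B + s∖B              ∎
          where
          f₁ : ∀ x y z → (x ∧ y) ∧ z ≡ true → x ∧ z ≡ true
          f₁ true true true _ = refl
          f₂ : ∀ x y z → (x ∧ y) ∧ not z ≡ true → y ∧ not z ≡ true
          f₂ true true false _ = refl

        union : s∖B + count B ωs ≤ count (λ ω → B ω ∨ s ω) ωs
        union = begin
          s∖B + count B ωs    ≡⟨ +-comm s∖B (count B ωs) ⟩
          count B ωs + s∖B    ≤⟨ +-mono-≤ (count-mono ωs (λ ω → e₁ (B ω) (s ω))) (count-mono ωs (λ ω → e₂ (B ω) (s ω))) ⟩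
          count (λ ω → (B ω ∨ s ω) ∧ B ω) ωs + count (λ ω → (B ω ∨ s ω) ∧ not (B ω)) ωs
                              ≡⟨ count-split (λ ω → B ω ∨ s ω) B ωs ⟨
          count (λ ω → B ω ∨ s ω) ωs  ∎
          where
          e₁ : ∀ x y → x ≡ true → (x ∨ y) ∧ x ≡ true
          e₁ true y _ = refl
          e₂ : ∀ x y → y ∧ not x ≡ true → (x ∨ y) ∧ not x ≡ true
          e₂ false true _ = refl

        -- The points of `t` already covered number at most `N / 2a`, half of what `big` guarantees;
        -- the other half must be new.
        2at∩B≤N : 2 * a * t∩B ≤ N
        2at∩B≤N = *-cancelʳ-≤ (2 * a * t∩B) N J {{subst NonZero (sym (steps≡ a)) _}} (begin
          2 * a * t∩B * J   ≡⟨ lem a t∩B J ⟩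
          2 * a * J * t∩B   ≡⟨ cong (_* t∩B) (threshold≡ a) ⟨
          b * t∩B           ≤⟨ small ⟩
          j * N             ≤⟨ *-monoˡ-≤ N j≤J ⟩
          J * N             ≡⟨ *-comm J N ⟩
          N * J             ∎)
          where
          lem : ∀ a t J → 2 * a * t * J ≡ 2 * a * J * t
          lem = solve-∀

        new : N ≤ 2 * a * s∖B
        new = +-cancelˡ-≤ N N (2 * a * s∖B) (begin
          N + N                        ≤⟨ +-mono-≤ big big ⟩
          a * t∩s + a * t∩s            ≡⟨ lem a t∩s ⟩
          2 * a * t∩s                  ≤⟨ *-monoʳ-≤ (2 * a) t∩s≤ ⟩
          2 * a * (t∩B + s∖B)          ≡⟨ *-distribˡ-+ (2 * a) t∩B s∖B ⟩
          2 * a * t∩B + 2 * a * s∖B    ≤⟨ +-monoˡ-≤ (2 * a * s∖B) 2at∩B≤N ⟩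
          N + 2 * a * s∖B              ∎)
          where
          lem : ∀ a t → a * t + a * t ≡ 2 * a * t
          lem = solve-∀

    -- After `j` rounds `B` is the union of the sets `S c` chosen so far. It has at least `j N / 2a`
    -- points, yet every remaining `x` has at most `j N / b` of them in `T x`.
    cover : G ⊎ Col R X₀ (J * m₁ + m₀)
    cover = go J 0 (+-identityʳ J) X₀ (λ _ → false) (λ _ p → p) z≤n
      (λ x _ → ≤-reflexive (trans (cong (b *_) (empty x)) (*-zeroʳ b)))
      where
      empty : ∀ x → count (λ ω → T x ω ∧ false) ωs ≡ 0
      empty x = n≤0⇒n≡0 (≤-trans (count-mono ωs {Q = λ _ → false} (λ ω p → proj₂ (∧-true {T x ω} p)))
                  (≤-reflexive (trans (∑-const 0 ωs) (*-zeroʳ N))))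

      go : ∀ s j → s + j ≡ J → (X : Fin n → Bool) (B : Ω → Bool) →
        (∀ x → X x ≡ true → X₀ x ≡ true) → j * N ≤ 2 * a * count B ωs →
        (∀ x → X x ≡ true → b * count (λ ω → T x ω ∧ B ω) ωs ≤ j * N) →
        G ⊎ Col R X (s * m₁ + m₀)
      -- After `steps a` rounds the union would be larger than `Ω`.
      go zero j refl X B X⊆ inv₁ inv₂ = ⊥-elim (<-irrefl refl (begin-strict
        2 * a * N           <⟨ m<n+m (2 * a * N) N≥1 ⟩
        suc (2 * a) * N     ≡⟨ cong (_* N) (steps≡ a) ⟨
        J * N               ≤⟨ inv₁ ⟩
        2 * a * count B ωs  ≤⟨ *-monoʳ-≤ (2 * a) (count≤length B ωs) ⟩
        2 * a * N           ∎))
        where open ≤-Reasoning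
      go (suc s) j eq X B X⊆ inv₁ inv₂ with pick X X⊆
      ... | inj₁ g        = inj₁ g
      ... | inj₂ (inj₁ c) = inj₂ (Col-mono (m≤n+m m₀ (suc s * m₁)) c)
      ... | inj₂ (inj₂ (x , Xx , c , big)) with split c
      ...   | inj₁ g = inj₁ g
      ...   | inj₂ col
        with go s (suc j) (trans (+-suc s j) eq) (λ u → X u ∧ not (class c u)) (λ ω → B ω ∨ S c ω)
               (λ x p → X⊆ x (proj₁ (∧-true p)))
               (gain (T x) (S c) B j (subst (j ≤_) eq (m≤n+m j (suc s))) big (inv₂ x Xx) inv₁) inv₂'
        where
        open ≤-Reasoning
        outside : ∀ y → not (class c y) ≡ true → b * meet y c ≤ N
        outside y p = <⇒≤ (≰⇒> (does-false (N ≤? b * meet y c) (not-true p)))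

        inv₂' : ∀ y → X y ∧ not (class c y) ≡ true →
          b * count (λ ω → T y ω ∧ (B ω ∨ S c ω)) ωs ≤ suc j * N
        inv₂' y p = begin
          b * count (λ ω → T y ω ∧ (B ω ∨ S c ω)) ωs
            ≤⟨ *-monoʳ-≤ b (≤-trans (≤-reflexive (count-split (λ ω → T y ω ∧ (B ω ∨ S c ω)) B ωs))
                 (+-mono-≤ (count-mono ωs (λ ω → e₁ (T y ω) (B ω) (S c ω))) (count-mono ωs (λ ω → e₂ (T y ω) (B ω) (S c ω))))) ⟩
          b * (count (λ ω → T y ω ∧ B ω) ωs + meet y c)
            ≡⟨ *-distribˡ-+ b _ (meet y c) ⟩
          b * count (λ ω → T y ω ∧ B ω) ωs + b * meet y c
            ≤⟨ +-mono-≤ (inv₂ y (proj₁ (∧-true p))) (outside y (proj₂ (∧-true {X y} p))) ⟩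
          j * N + N
            ≡⟨ +-comm (j * N) N ⟩
          suc j * N ∎
          where
          e₁ : ∀ x y z → (x ∧ (y ∨ z)) ∧ y ≡ true → x ∧ y ≡ true
          e₁ true true  z     _ = refl
          e₁ true false true  ()
          e₁ true false false ()
          e₂ : ∀ x y z → (x ∧ (y ∨ z)) ∧ not y ≡ true → x ∧ z ≡ true
          e₂ true false true _ = refl
      ...     | inj₁ g    = inj₁ g
      ...     | inj₂ rest = inj₂ (subst (Col R X) (sym (+-assoc m₁ (s * m₁) m₀))
                  (Col-∪ (class c) (λ u p q → ∧-intro p (cong not q)) col rest))

-- Cycles in dense digraphs

module CyclePaths {n : ℕ} (R : Fin n → Fin n → Bool) (irr : ∀ v → R v v ≡ false) where

  open Paths R irr public

  lastOf : Fin n → List (Fin n) → Fin n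
  lastOf v []       = v
  lastOf v (w ∷ ws) = lastOf w ws

  lastOf-∈ : ∀ v ws → lastOf v ws ∈ v ∷ ws
  lastOf-∈ v []       = here refl
  lastOf-∈ v (w ∷ ws) = there (lastOf-∈ w ws)

  IsPath-++ : ∀ {G v} ws {us} → IsPath G v ws → IsPath (λ j → G (length ws + j)) (lastOf v ws) us →
    IsPath G v (ws ++ us)
  IsPath-++ []       p       q = q
  IsPath-++ (w ∷ ws) (s , p) q = s , IsPath-++ ws p q

  IsPath-≡ : ∀ {G v ws us} → ws ≡ us → IsPath G v ws → IsPath G v us
  IsPath-≡ refl p = p

  record Cycle (G : ℕ → Bool) (k : ℕ) : Set where
    constructor cycle
    field
      start    : Fin n
      rest     : List (Fin n)
      isPath   : IsPath G start (rest ++ start ∷ [])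
      distinct : Unique (start ∷ rest)
      size     : suc (length rest) ≡ k

  step-T : ∀ {b u v} → b ≡ true → R u v ≡ true → Step b u v ≡ true
  step-T refl p = p

  step-F : ∀ {b u v} → b ≡ false → R v u ≡ true → Step b u v ≡ true
  step-F refl p = p

-- This is the vertex order of a cycle made of two disjoint paths and the two sinks that link them.
Unique-splice : ∀ {A : Set} {xs ys : List A} {x y} → Unique xs → Unique ys → (∀ {z} → z ∈ xs → z ∉ ys) →
  x ∉ xs ++ ys → y ∉ x ∷ xs ++ ys → Unique (xs ++ x ∷ ys ++ y ∷ [])
Unique-splice {xs = xs} {ys} {x} {y} u v apart x∉ y∉ = Unique.++⁺ u (All.tabulate x≢ ∷ Unique.++⁺ v ([] ∷ []) ys#y) xs#
  where
  ys#y : Disjoint ys (y ∷ [])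
  ys#y (i , here refl) = y∉ (there (∈-++⁺ʳ xs i))
  x≢ : ∀ {z} → z ∈ ys ++ y ∷ [] → x ≢ z
  x≢ i refl with ∈-++⁻ ys i
  ... | inj₁ j        = x∉ (∈-++⁺ʳ xs j)
  ... | inj₂ (here e) = y∉ (here (sym e))
  xs# : Disjoint xs (x ∷ ys ++ y ∷ [])
  xs# (i , here refl) = x∉ (∈-++⁺ˡ i)
  xs# (i , there j) with ∈-++⁻ ys j
  ... | inj₁ j'          = apart i j'
  ... | inj₂ (here refl) = y∉ (there (∈-++⁺ˡ i))

count-product : ∀ {A B : Set} (f : A → Bool) (g : B → Bool) xs ys →
  count (λ (x , y) → f x ∧ g y) (cartesianProduct xs ys) ≡ count f xs * count g ys
count-product f g []       ys = refl
count-product f g (x ∷ xs) ys =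
  trans (count-++ _ (map (x ,_) ys) (cartesianProduct xs ys))
  (trans (cong₂ _+_ (trans (count-map _ (x ,_) ys) (eq (f x))) (count-product f g xs ys))
  (sym (*-distribʳ-+ (count g ys) ⟦ f x ⟧ (count f xs))))
  where
  eq : ∀ b → count (λ y → b ∧ g y) ys ≡ ⟦ b ⟧ * count g ys
  eq true  = sym (+-identityʳ _)
  eq false = trans (∑-const 0 ys) (*-zeroʳ (length ys))

module Dense {n : ℕ} (R : Fin n → Fin n → Bool) (irr : ∀ v → R v v ≡ false)
  (q : ℕ) (dense : ∀ u → n ≤ q * count (R u) (allFin n)) (n≥1 : 1 ≤ n) where

  open CyclePaths R irr

  V : List (Fin n)
  V = allFin n

  N≡n : length V ≡ n
  N≡n = length-allFin n

  N≥1 : 1 ≤ length V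
  N≥1 = subst (1 ≤_) (sym N≡n) n≥1

  element? : (X : Fin n → Bool) → (∃ λ x → X x ≡ true) ⊎ Col R X 1
  element? X with findPath 0 (λ _ → true) X
  ... | inj₂ c = inj₂ c
  ... | inj₁ (x , path t p d (w ∷ _) z) = inj₁ (x , w)

  -- A proportion `1 / b` of more than `b * k` vertices is more than `k` vertices, which leaves room
  -- to avoid the rest of the cycle.
  many : ∀ {b k c} → n ≤ b * c → b * k < n → k < c
  many {b} {k} {c} h l = *-cancelˡ-< b k c (<-≤-trans l h)

  -- A path of `ℓ` edges from `v` to `u` is closed by the four edges `u → ω → t ← ω' ← v`.
  module FourEdges (ℓ : ℕ) (G : ℕ → Bool)
    (g₀ : G (ℓ + 0) ≡ true) (g₁ : G (ℓ + 1) ≡ true) (g₂ : G (ℓ + 2) ≡ false) (g₃ : G (ℓ + 3) ≡ false) where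

    k : ℕ
    k = 4 + ℓ

    open Cover R V R (λ t ω → R ω t) (q * q)

    -- At least `(n / q) * (n / q)` directed 2-paths start at `x`, so on average a vertex `t` ends
    -- `n / (q * q)` of them.
    pick : ∀ x → ∃ λ t → length V ≤ q * q * meet x t
    pick x = t , ≤-trans (≤-reflexive N≡n) (≤-pred lt)
      where
      total : n * n ≤ ∑ V (λ t → q * q * meet x t)
      total = begin
        n * n
          ≤⟨ *-monoˡ-≤ n (dense x) ⟩
        q * count (R x) V * n
          ≡⟨ lem q (count (R x) V) n ⟩
        q * (n * count (R x) V)
          ≡⟨ cong (q *_) (sym (∑-*ˡ n V (λ ω → ⟦ R x ω ⟧))) ⟩
        q * ∑ V (λ ω → n * ⟦ R x ω ⟧)
          ≤⟨ *-monoʳ-≤ q (∑-mono V two) ⟩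
        q * ∑ V (λ ω → q * count (λ t → R x ω ∧ R ω t) V)
          ≡⟨ cong (q *_) (∑-*ˡ q V (λ ω → count (λ t → R x ω ∧ R ω t) V)) ⟩
        q * (q * ∑ V (λ ω → count (λ t → R x ω ∧ R ω t) V))
          ≡⟨ *-assoc q q _ ⟨
        q * q * ∑ V (λ ω → count (λ t → R x ω ∧ R ω t) V)
          ≡⟨ cong (q * q *_) (∑-swap V V (λ ω t → ⟦ R x ω ∧ R ω t ⟧)) ⟩
        q * q * ∑ V (λ t → meet x t)
          ≡⟨ ∑-*ˡ (q * q) V (λ t → meet x t) ⟨
        ∑ V (λ t → q * q * meet x t) ∎
        where
        open ≤-Reasoning
        lem : ∀ q c n → q * c * n ≡ q * (n * c)
        lem = solve-∀
        two : ∀ ω → n * ⟦ R x ω ⟧ ≤ q * count (λ t → R x ω ∧ R ω t) V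
        two ω with R x ω
        ... | true  = ≤-trans (≤-reflexive (*-identityʳ n)) (dense ω)
        ... | false = ≤-trans (≤-reflexive (*-zeroʳ n)) z≤n

      -- Adding one to each term makes the comparison strict, as `∑-<` requires.
      found : ∃ λ t → n < suc (q * q * meet x t)
      found = ∑-< V (λ _ → n) (λ t → suc (q * q * meet x t)) (begin-strict
        ∑ V (λ _ → n)                              ≡⟨ ∑-const n V ⟩
        length V * n                               ≡⟨ cong (_* n) N≡n ⟩
        n * n                                      ≤⟨ total ⟩
        ∑ V (λ t → q * q * meet x t)               <⟨ m<n+m _ N≥1 ⟩
        length V + ∑ V (λ t → q * q * meet x t)    ≡⟨ cong (_+ ∑ V (λ t → q * q * meet x t)) (trans (sym (*-identityʳ _)) (sym (∑-const 1 V))) ⟩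
        ∑ V (λ _ → 1) + ∑ V (λ t → q * q * meet x t) ≡⟨ ∑-+ V (λ _ → 1) (λ t → q * q * meet x t) ⟨
        ∑ V (λ t → suc (q * q * meet x t))         ∎)
        where open ≤-Reasoning
      t  = proj₁ found
      lt = proj₂ found

    module _ (large : b * k < n) where

      -- Both ends of the path lie in the class of `t`, so each has more than `k` middle vertices
      -- towards `t`, while at most `ℓ + 3` vertices have to be avoided.
      close : ∀ t {v} → PathFrom (class t ∖∖ (t ∷ [])) G ℓ v → Cycle G k
      close t {v} (path ws p d w refl) = cycle v (ws ++ ω ∷ t ∷ ω' ∷ []) closed
        (Unique.++⁺ d ((ω≢t ∷ ω≢ω' ∷ []) ∷ (t≢ω' ∷ []) ∷ [] ∷ []) disj)
        (trans (cong suc (length-++ ws)) (lem (length ws)))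
        where
        lem : ∀ m → suc (m + 3) ≡ 4 + m
        lem = solve-∀
        inClass : ∀ u → u ∈ v ∷ ws → n ≤ b * meet u t × u ≢ t
        inClass u i =
          let c , u∉ = ∖∖-elim (class t) (t ∷ []) (All.lookup w i)
          in subst (_≤ b * meet u t) N≡n (does-true (length V ≤? b * meet u t) c) , λ e → u∉ (here e)
        u = lastOf v ws
        u∈ = lastOf-∈ v ws
        av₁ = t ∷ v ∷ ws
        pick₁ = fresh (λ ω → R u ω ∧ R ω t) av₁
          (≤-trans (s≤s (n≤1+n _)) (≤-trans (n≤1+n _) (many {b} (proj₁ (inClass u u∈)) large)))
        ω  = proj₁ pick₁
        ω∉ = proj₂ (proj₂ pick₁)
        pick₂ = fresh (λ ω → R v ω ∧ R ω t) (ω ∷ av₁)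
          (≤-trans (n≤1+n _) (many {b} (proj₁ (inClass v (here refl))) large))
        ω'  = proj₁ pick₂
        ω'∉ = proj₂ (proj₂ pick₂)
        arcs₁ = ∧-true (proj₁ (proj₂ pick₁))
        arcs₂ = ∧-true (proj₁ (proj₂ pick₂))
        ω≢t : ω ≢ t
        ω≢t e = ω∉ (here e)
        ω≢ω' : ω ≢ ω'
        ω≢ω' e = ω'∉ (here (sym e))
        t≢ω' : t ≢ ω'
        t≢ω' e = ω'∉ (there (here (sym e)))
        disj : Disjoint (v ∷ ws) (ω ∷ t ∷ ω' ∷ [])
        disj (i , here refl)                 = ω∉ (there i)
        disj (i , there (here refl))         = proj₂ (inClass _ i) refl
        disj (i , there (there (here refl))) = ω'∉ (there (there i))
        closed : IsPath G v ((ws ++ ω ∷ t ∷ ω' ∷ []) ++ v ∷ [])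
        closed = IsPath-≡ (sym (++-assoc ws _ _)) (IsPath-++ ws p
          (step-T g₀ (proj₁ arcs₁) , step-T g₁ (proj₂ arcs₁) ,
           step-F g₂ (proj₂ arcs₂) , step-F g₃ (proj₁ arcs₂) , tt))

      colours : ℕ
      -- The extra colour in each class is for `t`, which may lie in its own class and is removed
      -- before a path is sought.
      colours = J * suc (pathColours ℓ) + 1

      result : Cycle G k ⊎ Col R (λ _ → true) colours
      result = cover N≥1 (λ _ → true)
        (λ X _ → go (element? X))
        (λ t → split t (findPath ℓ G (class t ∖∖ (t ∷ []))))
        where
        go : ∀ {X} → (∃ λ x → X x ≡ true) ⊎ Col R X 1 →
          Cycle G k ⊎ Col R X 1 ⊎ (∃ λ x → X x ≡ true × ∃ λ t → length V ≤ q * q * meet x t)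
        go (inj₂ c)       = inj₂ (inj₁ c)
        go (inj₁ (x , p)) = inj₂ (inj₂ (x , p , pick x))
        split : ∀ t → (∃ λ v → PathFrom (class t ∖∖ (t ∷ [])) G ℓ v) ⊎ Col R (class t ∖∖ (t ∷ [])) (pathColours ℓ) →
          Cycle G k ⊎ Col R (class t) (suc (pathColours ℓ))
        split t (inj₁ (v , p)) = inj₁ (close t p)
        split t (inj₂ c)       = inj₂ (Col-∖∖ R irr (class t) (t ∷ []) c)

  -- Read cyclically, the pattern is a path of `ℓ₁` edges, a sink `t`, a path of `ℓ₂` edges with
  -- pattern `H`, and a sink `t'`. Copies of the second path are the centres.
  module TwoSinks (ℓ₁ ℓ₂ : ℕ) (G : ℕ → Bool)
    (g₀ : G (ℓ₁ + 0) ≡ true) (g₁ : G (ℓ₁ + 1) ≡ false)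
    (g₂ : G (ℓ₁ + (2 + (ℓ₂ + 0))) ≡ true) (g₃ : G (ℓ₁ + (2 + (ℓ₂ + 1))) ≡ false) where

    k : ℕ
    k = 4 + (ℓ₁ + ℓ₂)

    H : ℕ → Bool
    H j = G (ℓ₁ + (2 + j))

    share : Fin n → Fin n → ℕ
    share u v = count (λ ω → R u ω ∧ R v ω) V

    P : Set
    P = ∃ λ v → PathFrom (λ _ → true) H ℓ₂ v

    first last : P → Fin n
    first (v , _) = v
    last  (v , p) = lastOf v (PathFrom.rest p)

    vertices : P → List (Fin n)
    vertices (v , p) = v ∷ PathFrom.rest p

    b₁ : ℕ
    b₁ = threshold q

    module Inner (X₀ : Fin n → Bool) where

      -- Centres are taken from `X₀`, so that the centre of a class can be the vertex `x` of
      -- `Found`.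
      open Cover R {Centre = ∃ λ x → X₀ x ≡ true} V R (λ c ω → R (proj₁ c) ω) q

      Found : Set
      Found = ∃ λ x → X₀ x ≡ true × Σ P λ p → n ≤ b₁ * share x (first p) × n ≤ b₁ * share x (last p)

      share-comm : ∀ u v → share u v ≡ share v u
      share-comm u v = ∑-cong V (λ ω → cong ⟦_⟧ (Bool.∧-comm (R u ω) (R v ω)))

      share-self : ∀ u → n ≤ q * share u u
      share-self u = ≤-trans (dense u) (*-monoʳ-≤ q (count-mono V (λ ω e → ∧-intro e e)))

      -- Any remaining vertex can be its own centre, since its out-neighbourhood has proportion
      -- `1 / q`. A path in the class of a centre has all its vertices, in particular both ends,
      -- sharing many out-neighbours with that centre.
      inner : Found ⊎ Col R X₀ (J * pathColours ℓ₂ + 1)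
      inner = cover N≥1 X₀ (λ X X⊆ → go X X⊆ (element? X)) (λ c → split c (findPath ℓ₂ H (class c)))
        where
        go : ∀ X → (∀ x → X x ≡ true → X₀ x ≡ true) → (∃ λ x → X x ≡ true) ⊎ Col R X 1 →
          Found ⊎ Col R X 1 ⊎ (∃ λ x → X x ≡ true × ∃ λ c → length V ≤ q * meet x c)
        go X X⊆ (inj₂ c)       = inj₂ (inj₁ c)
        go X X⊆ (inj₁ (x , p)) = inj₂ (inj₂ (x , p , (x , X⊆ x p) , ≤-trans (≤-reflexive N≡n) (share-self x)))
        split : ∀ c → (∃ λ v → PathFrom (class c) H ℓ₂ v) ⊎ Col R (class c) (pathColours ℓ₂) →
          Found ⊎ Col R (class c) (pathColours ℓ₂)
        split c (inj₂ col) = inj₂ col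
        split c@(x , Xx) (inj₁ (v , p@(path ws _ _ w _))) =
          inj₁ (x , Xx , (v , PathFrom-⊆ (λ _ _ → refl) p) , near v (here refl) , near _ (lastOf-∈ v ws))
          where
          near : ∀ u → u ∈ v ∷ ws → n ≤ b₁ * share x u
          near u i = subst₂ (λ N s → N ≤ b₁ * s) N≡n (share-comm u x)
            (does-true (length V ≤? b * meet u c) (All.lookup w i))

    VV : List (Fin n × Fin n)
    VV = cartesianProduct V V

    N²≡ : length VV ≡ n * n
    N²≡ = trans (sym (count-all VV)) (trans (count-product (λ _ → true) (λ _ → true) V V)
      (cong₂ _*_ (trans (count-all V) N≡n) (trans (count-all V) N≡n)))

    -- With pairs as points of `Ω`, one density controls both ends of the centre path, because the
    -- count of pairs factors.
    open Cover R VV (λ x (α , β) → R x α ∧ R x β) (λ p (α , β) → R (first p) α ∧ R (last p) β) (b₁ * b₁)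

    meet≡ : ∀ x p → meet x p ≡ share x (first p) * share x (last p)
    meet≡ x p = trans (∑-cong VV (λ (α , β) → cong ⟦_⟧ (swap (R x α) (R x β) (R (first p) α) (R (last p) β))))
      (count-product (λ α → R x α ∧ R (first p) α) (λ β → R x β ∧ R (last p) β) V V)
      where
      swap : ∀ a b c d → (a ∧ b) ∧ (c ∧ d) ≡ (a ∧ c) ∧ (b ∧ d)
      swap true  true  c     d     = refl
      swap true  false true  d     = refl
      swap true  false false d     = refl
      swap false b     c     d     = refl

    -- If a product of two factors, each at most `n`, is at least `n * n / b`, then each factor is
    -- at least `n / b`.
    class⇒share : ∀ x p → class p x ≡ true → n ≤ b * share x (first p) × n ≤ b * share x (last p)
    class⇒share x p c = cancel s t (≤n x (last p)) h , cancel t s (≤n x (first p)) (≤-trans h (≤-reflexive (cong (b *_) (*-comm s t))))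
      where
      s t : ℕ
      s = share x (first p)
      t = share x (last p)
      ≤n : ∀ u v → share u v ≤ n
      ≤n u v = subst (share u v ≤_) N≡n (count≤length _ V)
      h : n * n ≤ b * (s * t)
      h = subst₂ (λ N m → N ≤ b * m) N²≡ (meet≡ x p) (does-true (length VV ≤? b * meet x p) c)
      cancel : ∀ s t → t ≤ n → n * n ≤ b * (s * t) → n ≤ b * s
      cancel s t t≤n h = *-cancelʳ-≤ n (b * s) n {{>-nonZero n≥1}}
        (≤-trans h (≤-trans (≤-reflexive (sym (*-assoc b s t))) (*-monoʳ-≤ (b * s) t≤n)))

    module _ (large : b * k < n) where

      -- `t` is a common out-neighbour of the end of the new path and the start of the centre path,
      -- and `t'` of the end of the centre path and the start of the new one. At most `ℓ₁ + ℓ₂ + 3`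
      -- vertices have to be avoided, fewer than `k`.
      close : ∀ p {v} → PathFrom (class p ∖∖ vertices p) G ℓ₁ v → Cycle G k
      close P@(p₀ , path ps pp pd pw refl) {v} (path ws qp qd qw refl) =
        cycle v (ws ++ t ∷ p₀ ∷ ps ++ t' ∷ []) closed
          (Unique-splice qd pd (λ {x} i → proj₂ (near x i)) t∉ t'∉)
          (trans (cong suc (trans (length-++ ws) (cong (λ l → length ws + (2 + l)) (length-++ ps)))) (lem (length ws) (length ps)))
        where
        lem : ∀ m n → suc (m + (2 + (n + 1))) ≡ 4 + (m + n)
        lem = solve-∀
        near : ∀ u → u ∈ v ∷ ws → (n ≤ b * share u p₀ × n ≤ b * share u (last P)) × u ∉ p₀ ∷ ps
        near u i =
          let c , u∉ = ∖∖-elim (class P) (p₀ ∷ ps) (All.lookup qw i) in class⇒share u P c , u∉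
        av : List (Fin n)
        av = (v ∷ ws) ++ (p₀ ∷ ps)
        length-av : length av ≡ 2 + (length ws + length ps)
        length-av = trans (length-++ (v ∷ ws)) (cong suc (+-suc (length ws) (length ps)))
        u = lastOf v ws
        pick₁ = fresh (λ ω → R u ω ∧ R p₀ ω) av
          (subst (_< share u p₀) (sym length-av)
            (≤-trans (n≤1+n _) (≤-trans (n≤1+n _) (many {b} (proj₁ (proj₁ (near u (lastOf-∈ v ws)))) large))))
        t    = proj₁ pick₁
        t∉   = proj₂ (proj₂ pick₁)
        pick₂ = fresh (λ ω → R v ω ∧ R (last P) ω) (t ∷ av)
          (subst (λ l → suc l < share v (last P)) (sym length-av)
            (≤-trans (n≤1+n _) (many {b} (proj₂ (proj₁ (near v (here refl)))) large)))
        t'   = proj₁ pick₂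
        t'∉  = proj₂ (proj₂ pick₂)
        arcs₁ = ∧-true (proj₁ (proj₂ pick₁))
        arcs₂ = ∧-true (proj₁ (proj₂ pick₂))
        closed : IsPath G v ((ws ++ t ∷ p₀ ∷ ps ++ t' ∷ []) ++ v ∷ [])
        closed = IsPath-≡ (trans (cong (λ l → ws ++ t ∷ p₀ ∷ l) (sym (++-assoc ps (t' ∷ []) (v ∷ [])))) (sym (++-assoc ws _ _)))
          (IsPath-++ ws qp (step-T g₀ (proj₁ arcs₁) , step-F g₁ (proj₂ arcs₁) ,
            IsPath-++ ps pp (step-T g₂ (proj₂ arcs₂) , step-F g₃ (proj₁ arcs₂) , tt)))

      colours : ℕ
      -- In each class the `ℓ₂ + 1` vertices of the centre path get colours of their own, since the
      -- new path must avoid them.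
      colours = J * (suc ℓ₂ + pathColours ℓ₁) + (steps q * pathColours ℓ₂ + 1)

      result : Cycle G k ⊎ Col R (λ _ → true) colours
      result = cover (≤-trans (*-mono-≤ n≥1 n≥1) (≤-reflexive (sym N²≡))) (λ _ → true)
        (λ X _ → go X (Inner.inner X))
        (λ p → split p (findPath ℓ₁ G (class p ∖∖ vertices p)))
        where
        m₀ : ℕ
        m₀ = steps q * pathColours ℓ₂ + 1
        go : ∀ X → Inner.Found X ⊎ Col R X m₀ →
          Cycle G k ⊎ Col R X m₀ ⊎ (∃ λ x → X x ≡ true × ∃ λ p → length VV ≤ b₁ * b₁ * meet x p)
        go X (inj₂ c) = inj₂ (inj₁ c)
        go X (inj₁ (x , Xx , p , s , t)) = inj₂ (inj₂ (x , Xx , p , (begin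
          length VV                                                  ≡⟨ N²≡ ⟩
          n * n                                                      ≤⟨ *-mono-≤ s t ⟩
          b₁ * share x (first p) * (b₁ * share x (last p))           ≡⟨ lem b₁ (share x (first p)) (share x (last p)) ⟩
          b₁ * b₁ * (share x (first p) * share x (last p))           ≡⟨ cong (b₁ * b₁ *_) (meet≡ x p) ⟨
          b₁ * b₁ * meet x p                                         ∎)))
          where
          open ≤-Reasoning
          lem : ∀ b s t → b * s * (b * t) ≡ b * b * (s * t)
          lem = solve-∀
        split : ∀ p → (∃ λ v → PathFrom (class p ∖∖ vertices p) G ℓ₁ v) ⊎ Col R (class p ∖∖ vertices p) (pathColours ℓ₁) →
          Cycle G k ⊎ Col R (class p) (suc ℓ₂ + pathColours ℓ₁)
        split p (inj₁ (v , w)) = inj₁ (close p w)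
        split p@(_ , path _ _ _ _ refl) (inj₂ c) = inj₂ (Col-∖∖ R irr (class p) (vertices p) c)

-- The bounds involve only `q` and `ℓ`, so the chromatic constant can be fixed before the digraph.
ttff-cycle : ∀ {n} (R : Fin n → Fin n → Bool) (irr : ∀ v → R v v ≡ false) q →
  (∀ u → n ≤ q * count (R u) (allFin n)) → 1 ≤ n → ∀ ℓ (G : ℕ → Bool) →
  G (ℓ + 0) ≡ true → G (ℓ + 1) ≡ true → G (ℓ + 2) ≡ false → G (ℓ + 3) ≡ false →
  threshold (q * q) * (4 + ℓ) < n →
  CyclePaths.Cycle R irr G (4 + ℓ) ⊎ Col R (λ _ → true) (steps (q * q) * suc (pathColours ℓ) + 1)
ttff-cycle R irr q dense n≥1 ℓ G g₀ g₁ g₂ g₃ large = Dense.FourEdges.result R irr q dense n≥1 ℓ G g₀ g₁ g₂ g₃ large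

two-descents-cycle : ∀ {n} (R : Fin n → Fin n → Bool) (irr : ∀ v → R v v ≡ false) q →
  (∀ u → n ≤ q * count (R u) (allFin n)) → 1 ≤ n → ∀ ℓ₁ ℓ₂ (G : ℕ → Bool) →
  G (ℓ₁ + 0) ≡ true → G (ℓ₁ + 1) ≡ false → G (ℓ₁ + (2 + (ℓ₂ + 0))) ≡ true → G (ℓ₁ + (2 + (ℓ₂ + 1))) ≡ false →
  threshold (threshold q * threshold q) * (4 + (ℓ₁ + ℓ₂)) < n →
  CyclePaths.Cycle R irr G (4 + (ℓ₁ + ℓ₂)) ⊎
  Col R (λ _ → true) (steps (threshold q * threshold q) * (suc ℓ₂ + pathColours ℓ₁) + (steps q * pathColours ℓ₂ + 1))
two-descents-cycle R irr q dense n≥1 ℓ₁ ℓ₂ G g₀ g₁ g₂ g₃ large =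
  Dense.TwoSinks.result R irr q dense n≥1 ℓ₁ ℓ₂ G g₀ g₁ g₂ g₃ large

-- Cyclic patterns of directions

nth : {A : Set} → A → List A → ℕ → A
nth d []       i       = d
nth d (x ∷ xs) zero    = x
nth d (x ∷ xs) (suc i) = nth d xs i

nth-All : {A : Set} {P : A → Set} (d : A) {xs : List A} → All P xs → ∀ i → i < length xs → P (nth d xs i)
nth-All d (p ∷ ps) zero    _       = p
nth-All d (p ∷ ps) (suc i) (s≤s h) = nth-All d ps i h

nth-injective : {A : Set} (d : A) {xs : List A} → Unique xs → ∀ i j → i < length xs → j < length xs →
  nth d xs i ≡ nth d xs j → i ≡ j
nth-injective d (p ∷ u) zero    zero    _       _       _ = refl
nth-injective d (p ∷ u) zero    (suc j) _       (s≤s h) e = contradiction e (nth-All d p j h)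
nth-injective d (p ∷ u) (suc i) zero    (s≤s h) _       e = contradiction (sym e) (nth-All d p i h)
nth-injective d (p ∷ u) (suc i) (suc j) (s≤s h) (s≤s l) e = cong suc (nth-injective d u i j h l e)

nth-++ˡ : {A : Set} (d : A) (xs : List A) {ys : List A} → ∀ i → i < length xs → nth d (xs ++ ys) i ≡ nth d xs i
nth-++ˡ d (x ∷ xs) zero    _       = refl
nth-++ˡ d (x ∷ xs) (suc i) (s≤s h) = nth-++ˡ d xs i h

nth-length : {A : Set} (d : A) (xs : List A) {y : A} → nth d (xs ++ y ∷ []) (length xs) ≡ y
nth-length d []       = refl
nth-length d (x ∷ xs) = nth-length d xs

-- A discrete intermediate value argument: follow `G` from `a` for as long as it stays true.
descent : (G : ℕ → Bool) (a d : ℕ) → G a ≡ true → G (a + d) ≡ false →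
  ∃ λ j → a ≤ j × j < a + d × G j ≡ true × G (suc j) ≡ false
descent G a zero    p q = ⊥-elim (true≢false p (trans (cong G (sym (+-identityʳ a))) q))
descent G a (suc d) p q with bool-split (G (suc a))
... | inj₂ r = a , ≤-refl , m<m+n a (s≤s z≤n) , p , r
... | inj₁ r with descent G (suc a) d r (trans (cong G (sym (+-suc a d))) q)
... | j , lo , hi , x , y = j , ≤-trans (n≤1+n a) lo , subst (j <_) (sym (+-suc a d)) hi , x , y

xor-true : ∀ {a b} → xor a b ≡ true → a ≢ b
xor-true {true}  {false} _ ()
xor-true {false} {true}  _ ()

≢-xor : ∀ {a b} → a ≢ b → xor a b ≡ true
≢-xor {true}  {true}  h = contradiction refl h
≢-xor {true}  {false} h = refl
≢-xor {false} {true}  h = refl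
≢-xor {false} {false} h = contradiction refl h

≢true⇒false : ∀ {b} → b ≢ true → b ≡ false
≢true⇒false {true}  h = contradiction refl h
≢true⇒false {false} h = refl

≢false⇒true : ∀ {b} → b ≢ false → b ≡ true
≢false⇒true {true}  h = refl
≢false⇒true {false} h = contradiction refl h

module Cyclic (m : ℕ) where

  k : ℕ
  k = suc (suc m)

  h : 2 ≤ k
  h = s≤s (s≤s z≤n)

  toℕ-cyc : ∀ a → toℕ (cyc h a) ≡ a % k
  toℕ-cyc a = Fin.toℕ-fromℕ< (m%n<n a k)

  cyc-cong : ∀ a b → a % k ≡ b % k → cyc h a ≡ cyc h b
  cyc-cong a b e = Fin.toℕ-injective (trans (toℕ-cyc a) (trans e (sym (toℕ-cyc b))))

  cyc-+k : ∀ a → cyc h (a + k) ≡ cyc h a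
  cyc-+k a = cyc-cong (a + k) a ([m+n]%n≡m%n a k)

  cyc-+*k : ∀ a b → cyc h (a + b * k) ≡ cyc h a
  cyc-+*k a b = cyc-cong (a + b * k) a ([m+kn]%n≡m%n a b k)

  cyc-toℕ : ∀ i → cyc h (toℕ i) ≡ i
  cyc-toℕ i = Fin.toℕ-injective (trans (toℕ-cyc (toℕ i)) (m<n⇒m%n≡m (Fin.toℕ<n i)))

  cyc-cyc : ∀ a b → cyc h (toℕ (cyc h a) + b) ≡ cyc h (a + b)
  cyc-cyc a b = cyc-cong (toℕ (cyc h a) + b) (a + b) (begin
    (toℕ (cyc h a) + b) % k       ≡⟨ cong (λ x → (x + b) % k) (toℕ-cyc a) ⟩
    (a % k + b) % k               ≡⟨ %-distribˡ-+ (a % k) b k ⟩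
    (a % k % k + b % k) % k       ≡⟨ cong (λ x → (x + b % k) % k) (m%n%n≡m%n a k) ⟩
    (a % k + b % k) % k           ≡⟨ %-distribˡ-+ a b k ⟨
    (a + b) % k                   ∎)
    where open ≡-Reasoning

  cyc-congˡ : ∀ a b c → cyc h a ≡ cyc h b → cyc h (a + c) ≡ cyc h (b + c)
  cyc-congˡ a b c e = trans (sym (cyc-cyc a c)) (trans (cong (λ i → cyc h (toℕ i + c)) e) (cyc-cyc b c))

  -- `s * (k - 1)` is congruent to `- s` modulo `k`, so rotations are undone without leaving the
  -- natural numbers.
  unshift : ℕ → ℕ
  unshift s = s * suc m

  cyc-unshift : ∀ a s → cyc h (a + s + unshift s) ≡ cyc h a
  cyc-unshift a s = trans (cong (cyc h) (lem a s m)) (cyc-+*k a s)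
    where
    lem : ∀ a s m → a + s + s * suc m ≡ a + s * suc (suc m)
    lem = solve-∀

  cyc-cancelʳ : ∀ a b s → cyc h (a + s) ≡ cyc h (b + s) → cyc h a ≡ cyc h b
  cyc-cancelʳ a b s e = trans (sym (cyc-unshift a s)) (trans (cyc-congˡ (a + s) (b + s) (unshift s) e) (cyc-unshift b s))

  cyc-injective : ∀ s {a b} → a < k → b < k → cyc h (s + a) ≡ cyc h (s + b) → a ≡ b
  cyc-injective s {a} {b} a<k b<k e = begin
    a              ≡⟨ m<n⇒m%n≡m a<k ⟨
    a % k          ≡⟨ toℕ-cyc a ⟨
    toℕ (cyc h a)  ≡⟨ cong toℕ (cyc-cancelʳ a b s (trans (cong (cyc h) (+-comm a s)) (trans e (cong (cyc h) (+-comm s b))))) ⟩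
    toℕ (cyc h b)  ≡⟨ toℕ-cyc b ⟩
    b % k          ≡⟨ m<n⇒m%n≡m b<k ⟩
    b              ∎
    where open ≡-Reasoning

  module Orientation (dir : Fin k → Bool) where

    g : ℕ → Bool
    g = dirAt h dir

    g-+k : ∀ a → g (a + k) ≡ g a
    g-+k a = cong dir (cyc-+k a)

    g-cyc : ∀ a b → g (toℕ (cyc h a) + b) ≡ g (a + b)
    g-cyc a b = cong dir (cyc-cyc a b)

    g-toℕ-cyc : ∀ a → g (toℕ (cyc h a)) ≡ g a
    g-toℕ-cyc a = trans (cong g (sym (+-identityʳ (toℕ (cyc h a))))) (trans (g-cyc a 0) (cong g (+-identityʳ a)))

    -- This is the condition counted by `numStarts`; adding `suc m`, that is `k - 1`, gives the
    -- preceding edge.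
    change : Fin k → Bool
    change s = xor (g (toℕ s + suc m)) (g (toℕ s))

    change-cyc : ∀ a → g a ≢ g (suc a) → change (cyc h (suc a)) ≡ true
    change-cyc a ne = ≢-xor λ e → ne (begin
      g a                               ≡⟨ g-+k a ⟨
      g (a + suc (suc m))               ≡⟨ cong g (+-suc a (suc m)) ⟩
      g (suc a + suc m)                 ≡⟨ g-cyc (suc a) (suc m) ⟨
      g (toℕ (cyc h (suc a)) + suc m)   ≡⟨ e ⟩
      g (toℕ (cyc h (suc a)))           ≡⟨ g-toℕ-cyc (suc a) ⟩
      g (suc a)                         ∎)
      where open ≡-Reasoning

    cyc-change : ∀ a → change (cyc h (suc a)) ≡ true → g a ≢ g (suc a)
    cyc-change a c e = xor-true c (begin
      g (toℕ (cyc h (suc a)) + suc m)   ≡⟨ g-cyc (suc a) (suc m) ⟩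
      g (suc a + suc m)                 ≡⟨ cong g (+-suc a (suc m)) ⟨
      g (a + suc (suc m))               ≡⟨ g-+k a ⟩
      g a                               ≡⟨ e ⟩
      g (suc a)                         ≡⟨ g-toℕ-cyc (suc a) ⟨
      g (toℕ (cyc h (suc a)))           ∎)
      where open ≡-Reasoning

    -- Either the change at `i` is itself a descent, or it is an ascent and the sequence must fall
    -- again before it gets round to the edge preceding `i`.
    change⇒descent : ∀ i → change i ≡ true → ∃ λ s → g s ≡ true × g (suc s) ≡ false
    change⇒descent i c with bool-split (g (toℕ i))
    ... | inj₂ p = toℕ i + suc m , ≢false⇒true (λ q → xor-true c (trans q (sym p))) ,
            trans (cong g (sym (+-suc (toℕ i) (suc m)))) (trans (g-+k (toℕ i)) p)
    ... | inj₁ p with descent g (toℕ i) (suc m) p (≢true⇒false (λ q → xor-true c (trans q (sym p))))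
    ...   | j , _ , _ , x , y = j , x , y

    starts≥1⇒descent : 1 ≤ numStarts h dir → ∃ λ s → g s ≡ true × g (suc s) ≡ false
    starts≥1⇒descent le = let i , c = count-pos change (allFin k) le in change⇒descent i c

    edge-true : ∀ {D} (c : Contains D h dir) a → g a ≡ true →
      arc D (proj₁ c (cyc h a)) (proj₁ c (cyc h (suc a))) ≡ true
    edge-true {D} (f , _ , e) a p = subst₂ (λ x y → arc D (f x) (f y) ≡ true) t s (e (cyc h a))
      where
      t : tailC h dir (cyc h a) ≡ cyc h a
      t rewrite p = cyc-toℕ (cyc h a)
      s : headC h dir (cyc h a) ≡ cyc h (suc a)
      s rewrite p = trans (cong (cyc h) (+-comm 1 (toℕ (cyc h a)))) (trans (cyc-cyc a 1) (cong (cyc h) (+-comm a 1)))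

    edge-false : ∀ {D} (c : Contains D h dir) a → g a ≡ false →
      arc D (proj₁ c (cyc h (suc a))) (proj₁ c (cyc h a)) ≡ true
    edge-false {D} (f , _ , e) a p = subst₂ (λ x y → arc D (f x) (f y) ≡ true) t s (e (cyc h a))
      where
      s : headC h dir (cyc h a) ≡ cyc h a
      s rewrite p = cyc-toℕ (cyc h a)
      t : tailC h dir (cyc h a) ≡ cyc h (suc a)
      t rewrite p = trans (cong (cyc h) (+-comm 1 (toℕ (cyc h a)))) (trans (cyc-cyc a 1) (cong (cyc h) (+-comm a 1)))

    -- On a cycle a descent is accompanied by an ascent, so any change yields two block starts.
    few-starts⇒constant : numStarts h dir ≤ 1 → ∀ a → g (suc a) ≡ g a
    few-starts⇒constant le a with g (suc a) Bool.≟ g a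
    ... | yes e = e
    ... | no ne with change⇒descent (cyc h (suc a)) (change-cyc a (ne ∘ sym))
    -- The ascent is found as a descent of the negated sequence, between `suc s` and `s + k`.
    ...   | s , p , q with descent (not ∘ g) (suc s) (suc m) (cong not q)
                            (cong not (trans (cong g (sym (+-suc s (suc m)))) (trans (g-+k s) p)))
    ...     | j , _ , _ , x , y = contradiction le (<⇒≱ (Unique-count change (cyc h (suc s) ∷ cyc h (suc j) ∷ [])
                 ((apart ∷ []) ∷ [] ∷ []) (change-cyc s s≢ ∷ change-cyc j j≢ ∷ [])))
      where
      notf : ∀ {b} → not b ≡ false → b ≡ true
      notf {true} _ = refl
      apart : cyc h (suc s) ≢ cyc h (suc j)
      apart e = true≢false (notf y) (trans (sym (cong dir e)) q)
      s≢ : g s ≢ g (suc s)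
      s≢ e = true≢false p (trans e q)
      j≢ : g j ≢ g (suc j)
      j≢ e = true≢false (notf y) (trans (sym e) (not-true x))

    -- A directed cycle is followed along its arcs: upwards from index 0 if the edges are true,
    -- downwards from index `k` if they are false.
    constant⇒closedWalk : ∀ {D} → (∀ a → g (suc a) ≡ g a) → Contains D h dir →
      ∃ λ w → (∀ i → i < k → arc D (w i) (w (suc i)) ≡ true) × w k ≡ w 0
    constant⇒closedWalk {D} const c with bool-split (g 0)
    ... | inj₁ p = (λ i → proj₁ c (cyc h i)) , (λ i _ → edge-true {D} c i (all i)) , cong (proj₁ c) (cyc-+k 0)
      where
      all : ∀ a → g a ≡ true
      all zero    = p
      all (suc a) = trans (const a) (all a)
    ... | inj₂ p = (λ i → proj₁ c (cyc h (k ∸ i))) ,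
          (λ i lt → subst (λ x → arc D (proj₁ c (cyc h x)) (proj₁ c (cyc h (k ∸ suc i))) ≡ true)
                      (suc-∸ i lt) (edge-false {D} c (k ∸ suc i) (all (k ∸ suc i)))) ,
          cong (proj₁ c) (trans (cong (cyc h) (n∸n≡0 k)) (sym (cyc-+k 0)))
      where
      suc-∸ : ∀ i → i < k → suc (k ∸ suc i) ≡ k ∸ i
      suc-∸ i lt = sym (+-∸-assoc 1 lt)
      all : ∀ a → g a ≡ false
      all zero    = p
      all (suc a) = trans (const a) (all a)

    ShortBlock : Set
    ShortBlock = ∃ λ s → BlockOfLength h dir s 1

    -- The starts at `s` and at the next edge are the only two, so a later change before returning
    -- to `s` would be a third.
    shortBlock⇒rest : numStarts h dir ≡ 2 → ((s , _) : ShortBlock) → ∀ j → j < suc m → g (toℕ s + suc j) ≡ not (g (toℕ s))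
    shortBlock⇒rest two (s , start , _ , _ , end) = go
      where
      S = toℕ s
      ≢⇒not : ∀ {a b} → a ≢ b → a ≡ not b
      ≢⇒not {true}  {true}  ne = contradiction refl ne
      ≢⇒not {true}  {false} ne = refl
      ≢⇒not {false} {true}  ne = refl
      ≢⇒not {false} {false} ne = contradiction refl ne
      sucS : S + 1 ≡ suc S
      sucS = +-comm S 1
      go : ∀ j → j < suc m → g (S + suc j) ≡ not (g S)
      go zero    _  = ≢⇒not end
      go (suc j) lt with g (S + suc (suc j)) Bool.≟ not (g S)
      ... | yes e = e
      ... | no ne = contradiction (Unique-count change (s ∷ cyc h (suc S) ∷ cyc h (suc (S + suc j)) ∷ [])
              ((a₁ ∷ a₂ ∷ []) ∷ (a₃ ∷ []) ∷ [] ∷ [])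
              (≢-xor start ∷ change-cyc S c₂ ∷ change-cyc (S + suc j) c₃ ∷ [])) (<⇒≱ (subst (_< 3) (sym two) ≤-refl))
        where
        ih = go j (<⇒≤ lt)
        c₂ : g S ≢ g (suc S)
        c₂ e = end (trans (cong g sucS) (sym e))
        c₃ : g (S + suc j) ≢ g (suc (S + suc j))
        c₃ e = ne (trans (cong g (+-suc S (suc j))) (trans (sym e) ih))
        at-zero : cyc h (S + 0) ≡ s
        at-zero = trans (cong (cyc h) (+-identityʳ S)) (cyc-toℕ s)
        a₁ : s ≢ cyc h (suc S)
        a₁ e with cyc-injective S {0} {1} (s≤s z≤n) (s≤s (s≤s z≤n)) (trans at-zero (trans e (cong (cyc h) (sym sucS))))
        ... | ()
        a₂ : s ≢ cyc h (suc (S + suc j))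
        a₂ e with cyc-injective S {0} {suc (suc j)} (s≤s z≤n) (s≤s lt) (trans at-zero (trans e (cong (cyc h) (sym (+-suc S (suc j))))))
        ... | ()
        a₃ : cyc h (suc S) ≢ cyc h (suc (S + suc j))
        a₃ e with cyc-injective S {1} {suc (suc j)} (s≤s (s≤s z≤n)) (s≤s lt)
                    (trans (cong (cyc h) sucS) (trans e (cong (cyc h) (sym (+-suc S (suc j))))))
        ... | ()

    -- The long block is a directed path with `k - 1` arcs, and the short block is an arc from its
    -- first vertex to its last. The direction of the short block decides which way round the path
    -- is read.
    shortBlock⇒chord : ∀ {D} → numStarts h dir ≡ 2 → ShortBlock → Contains D h dir →
      ∃ λ w → (∀ i → i < suc m → arc D (w i) (w (suc i)) ≡ true) × arc D (w 0) (w (suc m)) ≡ true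
    shortBlock⇒chord {D} two sb@(s , _) c with bool-split (g (toℕ s))
    ... | inj₁ p = (λ i → v (S + (k ∸ i))) , step , subst₂ (λ x y → arc D x y ≡ true)
          (cong (proj₁ c) (sym (cyc-+k S))) (cong v (trans (+-comm 1 S) (cong (S +_) (sym one))))
          (edge-true {D} c S p)
      where
      S = toℕ s
      v = λ a → proj₁ c (cyc h a)
      one : suc (suc m) ∸ suc m ≡ 1
      one = m+n∸n≡m 1 (suc m)
      step : ∀ i → i < suc m → arc D (v (S + (k ∸ i))) (v (S + (k ∸ suc i))) ≡ true
      step i (s≤s i≤m) = subst₂ (λ x y → arc D (v x) (v y) ≡ true) eq₁ eq₂
        (edge-false {D} c (S + suc (m ∸ i)) (trans (shortBlock⇒rest two sb (m ∸ i) (s≤s (m∸n≤m m i))) (cong not p)))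
        where
        e : suc m ∸ i ≡ suc (m ∸ i)
        e = +-∸-assoc 1 i≤m
        eq₁ : suc (S + suc (m ∸ i)) ≡ S + (k ∸ i)
        eq₁ = trans (sym (+-suc S _)) (cong (S +_) (sym (+-∸-assoc 2 i≤m)))
        eq₂ : S + suc (m ∸ i) ≡ S + (k ∸ suc i)
        eq₂ = cong (S +_) (sym e)
    ... | inj₂ p = (λ i → v (suc (S + i))) , step , subst₂ (λ x y → arc D x y ≡ true)
          (cong (λ a → v (suc a)) (sym (+-identityʳ S))) (cong (proj₁ c) (trans (sym (cyc-+k S)) (cong (cyc h) (+-suc S (suc m)))))
          (edge-false {D} c S p)
      where
      S = toℕ s
      v = λ a → proj₁ c (cyc h a)
      step : ∀ i → i < suc m → arc D (v (suc (S + i))) (v (suc (S + suc i))) ≡ true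
      step i lt = subst (λ x → arc D (v x) (v (suc (S + suc i))) ≡ true) (+-suc S i)
        (edge-true {D} c (S + suc i) (trans (shortBlock⇒rest two sb i lt) (cong not p)))

    -- A descent between blocks of length at least two is preceded by true and followed by false.
    long-blocks⇒ttff : 1 ≤ numStarts h dir → (∀ s L → BlockOfLength h dir s L → 2 ≤ L) →
      ∃ λ s → ∃ λ ℓ → k ≡ 4 + ℓ × g (s + (ℓ + 0)) ≡ true × g (s + (ℓ + 1)) ≡ true ×
        g (s + (ℓ + 2)) ≡ false × g (s + (ℓ + 3)) ≡ false
    long-blocks⇒ttff le long with starts≥1⇒descent le
    ... | s , p , q = finish m refl
      where
      -- Changes on both sides of edge `a` would make it a block of length one.
      block : ∀ a → g (a + suc m) ≢ g a → g (suc a) ≢ g a → ⊥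
      block a x y = contradiction (long (cyc h a) 1 (start , s≤s z≤n , inside , end)) λ { (s≤s ()) }
        where
        start : g (toℕ (cyc h a) + suc m) ≢ g (toℕ (cyc h a))
        start e = x (trans (sym (g-cyc a (suc m))) (trans e (g-toℕ-cyc a)))
        inside : ∀ j → j < 1 → g (toℕ (cyc h a) + j) ≡ g (toℕ (cyc h a))
        inside zero _ = cong g (+-identityʳ (toℕ (cyc h a)))
        inside (suc j) (s≤s ())
        end : g (toℕ (cyc h a) + 1) ≢ g (toℕ (cyc h a))
        end e = y (trans (cong g (+-comm 1 a)) (trans (sym (g-cyc a 1)) (trans e (g-toℕ-cyc a))))

      sk : g (suc s + suc m) ≡ g s
      sk = trans (cong g (sym (+-suc s (suc m)))) (g-+k s)

      next : g (suc (suc s)) ≡ false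
      next = ≢true⇒false λ e → block (suc s)
        (λ e' → true≢false p (trans (sym sk) (trans e' q))) (λ e' → true≢false e (trans e' q))

      prev : g (s + suc m) ≡ true
      prev = ≢false⇒true λ e → block s (λ e' → true≢false (trans e' p) e) (λ e' → true≢false (trans e' p) q)

      finish : ∀ m' → m ≡ m' → ∃ λ s → ∃ λ ℓ → k ≡ 4 + ℓ × g (s + (ℓ + 0)) ≡ true × g (s + (ℓ + 1)) ≡ true ×
        g (s + (ℓ + 2)) ≡ false × g (s + (ℓ + 3)) ≡ false
      -- For `k` equal to 2 or 3 the four edges around the descent overlap with conflicting
      -- directions.
      finish zero refl = ⊥-elim (true≢false p (trans (sym (g-+k s)) (trans (cong g (+-comm s 2)) next)))
      finish (suc zero) refl = ⊥-elim (true≢false prev (trans (cong g (+-comm s 2)) next))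
      -- Starting at `3 + s` puts the edges `s - 1`, `s`, `s + 1`, `s + 2` at the end of the cyclic
      -- order, after the `ℓ` others.
      finish (suc (suc ℓ)) refl = 3 + s , ℓ , refl ,
        trans (cong g (e₀ s ℓ)) prev ,
        trans (cong g (e₁ s ℓ)) (trans (g-+k s) p) ,
        trans (cong g (e₂ s ℓ)) (trans (g-+k (suc s)) q) ,
        trans (cong g (e₃ s ℓ)) (trans (g-+k (2 + s)) next)
        where
        e₀ : ∀ s ℓ → 3 + s + (ℓ + 0) ≡ s + (3 + ℓ)
        e₀ = solve-∀
        e₁ : ∀ s ℓ → 3 + s + (ℓ + 1) ≡ s + (4 + ℓ)
        e₁ = solve-∀
        e₂ : ∀ s ℓ → 3 + s + (ℓ + 2) ≡ suc s + (4 + ℓ)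
        e₂ = solve-∀
        e₃ : ∀ s ℓ → 3 + s + (ℓ + 3) ≡ 2 + s + (4 + ℓ)
        e₃ = solve-∀

module CyclicPatterns (m : ℕ) where

  open Cyclic m

  module _ (dir : Fin k → Bool) where

    open Orientation dir

    TwoDescents : Set
    TwoDescents = ∃ λ s → ∃ λ ℓ₁ → ∃ λ ℓ₂ → k ≡ 4 + (ℓ₁ + ℓ₂) ×
        g (s + (ℓ₁ + 0)) ≡ true × g (s + (ℓ₁ + 1)) ≡ false ×
        g (s + (ℓ₁ + (2 + (ℓ₂ + 0)))) ≡ true × g (s + (ℓ₁ + (2 + (ℓ₂ + 1)))) ≡ false

    -- A third change of direction, besides the descent at the end, yields two ascents, hence another descent between them.
    many-blocks⇒two-descents : 3 ≤ numStarts h dir → TwoDescents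
    many-blocks⇒two-descents le with starts≥1⇒descent (≤-trans (s≤s z≤n) le)
    ... | s , p , q = finish another
      where
      -- The rotation puts the known descent at the last two positions, `m` and `m + 1`.
      G : ℕ → Bool
      G j = g (suc (suc s) + j)

      Gm : G m ≡ true
      Gm = trans (cong g (lem s m)) (trans (g-+k s) p)
        where
        lem : ∀ s m → suc (suc s) + m ≡ s + suc (suc m)
        lem = solve-∀

      Gm+1 : G (suc m) ≡ false
      Gm+1 = trans (cong g (lem s m)) (trans (g-+k (suc s)) q)
        where
        lem : ∀ s m → suc (suc s) + suc m ≡ suc s + suc (suc m)
        lem = solve-∀

      Another : Set
      Another = ∃ λ j → suc (suc j) ≤ m × G j ≡ true × G (suc j) ≡ false

      -- The edge before position 0 is `suc s`, where `g` is false by `q`; hence only one condition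
      -- there.
      Ascent : ℕ → Set
      Ascent zero    = G 0 ≡ true
      Ascent (suc a) = G a ≡ false × G (suc a) ≡ true

      ascent-true : ∀ a → Ascent a → G a ≡ true
      ascent-true zero    x       = x
      ascent-true (suc a) (_ , x) = x

      -- This is the position of `i` after the rotation, that is `i - (s + 2)` modulo `k`.
      rank : Fin k → ℕ
      rank i = toℕ (cyc h (toℕ i + unshift (suc (suc s))))

      cyc-rank : ∀ i → cyc h (suc (suc s) + rank i) ≡ i
      cyc-rank i = begin
        cyc h (suc (suc s) + rank i)                          ≡⟨ cong (cyc h) (+-comm (suc (suc s)) (rank i)) ⟩
        cyc h (rank i + suc (suc s))                          ≡⟨ cyc-cyc (toℕ i + unshift (suc (suc s))) (suc (suc s)) ⟩
        cyc h (toℕ i + unshift (suc (suc s)) + suc (suc s))    ≡⟨ cong (cyc h) (lem (toℕ i) (unshift (suc (suc s))) (suc (suc s))) ⟩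
        cyc h (toℕ i + suc (suc s) + unshift (suc (suc s)))    ≡⟨ cyc-unshift (toℕ i) (suc (suc s)) ⟩
        cyc h (toℕ i)                                          ≡⟨ cyc-toℕ i ⟩
        i                                                      ∎
        where
        open ≡-Reasoning
        lem : ∀ a b c → a + b + c ≡ a + c + b
        lem = solve-∀

      -- A change away from the known descent is an ascent or a new descent. A new descent cannot
      -- end at `m`, where `G` is true, so it is disjoint from the known one.
      classify : ∀ i → change i ≡ true → i ≢ cyc h (suc (suc s) + suc m) → ∀ a → rank i ≡ a → Another ⊎ Ascent a × a ≤ m
      classify i c i≢ a ia = go a i≡ (≤-pred (subst (_< k) ia (Fin.toℕ<n _)))
        where
        i≡ : i ≡ cyc h (suc (suc s) + a)
        i≡ = trans (sym (cyc-rank i)) (cong (λ x → cyc h (suc (suc s) + x)) ia)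
        ≢⇒asc : ∀ {a b} → a ≢ b → b ≡ true → a ≡ false
        ≢⇒asc ne refl = ≢true⇒false ne
        ne : ∀ a → i ≡ cyc h (suc (suc s) + a) → g (suc s + a) ≢ G a
        ne a e = cyc-change (suc s + a) (subst (λ i → change i ≡ true) e c)
        go : ∀ a → i ≡ cyc h (suc (suc s) + a) → a ≤ suc m → Another ⊎ Ascent a × a ≤ m
        go zero e _ = inj₂ (≢false⇒true (λ x → ne 0 e (trans (trans (cong g (+-identityʳ (suc s))) q) (sym x))) , z≤n)
        go (suc a) e le with m≤n⇒m<n∨m≡n le
        ... | inj₂ refl = contradiction e i≢
        ... | inj₁ (s≤s a<m) with bool-split (G (suc a))
        ...   | inj₁ x = inj₂ ((≢⇒asc (λ y → ne (suc a) e (trans (cong g (+-suc (suc s) a)) y)) x , x) , a<m)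
        ...   | inj₂ x with m≤n⇒m<n∨m≡n a<m
        ...     | inj₂ refl = ⊥-elim (true≢false Gm x)
        ...     | inj₁ a+1<m = inj₁ (a , a+1<m ,
                    ≢false⇒true (λ y → ne (suc a) e (trans (cong g (+-suc (suc s) a)) (trans y (sym x)))) , x)

      -- The sequence is true at the first ascent and false just before the second, so it falls in
      -- between.
      between : ∀ a b → a < b → Ascent a → Ascent b → b ≤ m → Another
      between a (suc b) (s≤s a≤b) x (y , _) b<m
        with descent G a (b ∸ a) (ascent-true a x) (trans (cong G (m+[n∸m]≡n a≤b)) y)
      ... | j , _ , hi , u , v = j , ≤-trans (s≤s (subst (j <_) (m+[n∸m]≡n a≤b) hi)) b<m , u , v

      last : Fin k
      last = cyc h (suc (suc s) + suc m)

      another : Another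
      -- Three changes leave at least two besides the one at `last`, which belongs to the known
      -- descent.
      another with fresh change (last ∷ []) (≤-trans (n≤1+n _) le)
      ... | i , ci , i∉ with fresh change (last ∷ i ∷ []) le
      ...   | j , cj , j∉ with classify i ci (λ e → i∉ (here e)) _ refl | classify j cj (λ e → j∉ (here e)) _ refl
      ...     | inj₁ r       | _              = r
      ...     | inj₂ _       | inj₁ r         = r
      ...     | inj₂ (x , a≤) | inj₂ (y , b≤) with <-cmp (rank i) (rank j)
      ...       | tri< lt _ _ = between _ _ lt x y b≤
      ...       | tri> _ _ gt = between _ _ gt y x a≤
      ...       | tri≈ _ e _  = contradiction
                    (trans (sym (cyc-rank j)) (trans (cong (λ x → cyc h (suc (suc s) + x)) (sym e)) (cyc-rank i)))
                    (λ j≡i → j∉ (there (here j≡i)))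

      finish : Another → TwoDescents
      finish (j , j+2≤m , x , y) = suc (suc s) , j , m ∸ (2 + j) ,
        cong (λ x → suc (suc x)) (sym whole) ,
        trans (cong G (+-identityʳ j)) x ,
        trans (cong G (+-comm j 1)) y ,
        trans (cong G (trans (e₀ j (m ∸ (2 + j))) whole)) Gm ,
        trans (cong G (trans (e₁ j (m ∸ (2 + j))) (cong suc whole))) Gm+1
        where
        whole : 2 + j + (m ∸ (2 + j)) ≡ m
        whole = m+[n∸m]≡n j+2≤m
        e₀ : ∀ j d → j + (2 + (d + 0)) ≡ 2 + j + d
        e₀ = solve-∀
        e₁ : ∀ j d → j + (2 + (d + 1)) ≡ suc (2 + j + d)
        e₁ = solve-∀

  module _ (D : Digraph) (dir : Fin k → Bool) where

    open Orientation dir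
    open CyclePaths (arc D) (loopless D)

    IsPath-nth : ∀ d {G v} ws → IsPath G v ws → ∀ i → i < length ws →
      Step (G i) (nth d (v ∷ ws) i) (nth d (v ∷ ws) (suc i)) ≡ true
    IsPath-nth d (w ∷ ws) (p , _)  zero    _        = p
    IsPath-nth d (w ∷ ws) (_ , ps) (suc i) (s≤s lt) = IsPath-nth d ws ps i lt

    -- The cycle was found with its pattern rotated by `s`, so vertex `i` of `C` is placed at
    -- position `i - s` modulo `k` of the list.
    cycle⇒contains : ∀ s {k'} → k ≡ k' → Cycle (λ j → g (s + j)) k' → Contains D h dir
    cycle⇒contains s refl (cycle v ws p u size) = f , inj , arcs
      where
      l : List (Fin (n D))
      l = v ∷ ws

      pos : ℕ → Fin k
      pos a = cyc h (a + unshift s)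

      f : Fin k → Fin (n D)
      f i = nth v l (toℕ (pos (toℕ i)))

      inRange : ∀ (i : Fin k) → toℕ i < length l
      inRange i = subst (toℕ i <_) (sym size) (Fin.toℕ<n i)

      shift-pos : ∀ a → cyc h (s + toℕ (pos a)) ≡ cyc h a
      shift-pos a = begin
        cyc h (s + toℕ (pos a))       ≡⟨ cong (cyc h) (+-comm s (toℕ (pos a))) ⟩
        cyc h (toℕ (pos a) + s)       ≡⟨ cyc-cyc (a + unshift s) s ⟩
        cyc h (a + unshift s + s)     ≡⟨ cong (cyc h) (lem a (unshift s) s) ⟩
        cyc h (a + s + unshift s)     ≡⟨ cyc-unshift a s ⟩
        cyc h a                       ∎
        where
        open ≡-Reasoning
        lem : ∀ a b c → a + b + c ≡ a + c + b
        lem = solve-∀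

      inj : ∀ {i j} → f i ≡ f j → i ≡ j
      inj {i} {j} e = begin
        i                               ≡⟨ cyc-toℕ i ⟨
        cyc h (toℕ i)                   ≡⟨ shift-pos (toℕ i) ⟨
        cyc h (s + toℕ (pos (toℕ i)))   ≡⟨ cong (λ x → cyc h (s + x)) (nth-injective v u _ _ (inRange _) (inRange _) e) ⟩
        cyc h (s + toℕ (pos (toℕ j)))   ≡⟨ shift-pos (toℕ j) ⟩
        cyc h (toℕ j)                   ≡⟨ cyc-toℕ j ⟩
        j                               ∎
        where open ≡-Reasoning

      next : ∀ e → e < k → nth v (l ++ v ∷ []) (suc e) ≡ nth v l (toℕ (cyc h (suc e)))
      next e lt with m≤n⇒m<n∨m≡n lt
      ... | inj₁ lt' = trans (nth-++ˡ v l (suc e) (subst (suc e <_) (sym size) lt'))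
                         (cong (nth v l) (sym (trans (toℕ-cyc (suc e)) (m<n⇒m%n≡m lt'))))
      ... | inj₂ eq  = trans (cong (nth v (l ++ v ∷ [])) (trans eq (sym size)))
                         (trans (nth-length v l)
                           (cong (nth v l) (sym (trans (toℕ-cyc (suc e)) (trans (cong (_% k) eq) (n%n≡0 k))))))

      fcyc : ∀ a → f (cyc h a) ≡ nth v l (toℕ (pos a))
      fcyc a = cong (λ i → nth v l (toℕ i)) (cyc-cyc a (unshift s))

      edge : ∀ i → Step (dir i) (f i) (f (cyc h (suc (toℕ i)))) ≡ true
      edge i = subst₂ (λ b w → Step b (f i) w ≡ true) db w≡
        (subst (λ x → Step (g (s + e)) x (nth v (l ++ v ∷ []) (suc e)) ≡ true)
          (nth-++ˡ v l e (inRange (pos (toℕ i))))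
          (IsPath-nth v (ws ++ v ∷ []) p e (subst (e <_) (sym len) (Fin.toℕ<n (pos (toℕ i))))))
        where
        e = toℕ (pos (toℕ i))
        len : length (ws ++ v ∷ []) ≡ k
        len = trans (length-++ ws) (trans (+-comm (length ws) 1) size)
        db : g (s + e) ≡ dir i
        db = cong dir (trans (shift-pos (toℕ i)) (cyc-toℕ i))
        w≡ : nth v (l ++ v ∷ []) (suc e) ≡ f (cyc h (suc (toℕ i)))
        w≡ = trans (next e (Fin.toℕ<n (pos (toℕ i)))) (trans (cong (λ j → nth v l (toℕ j)) same) (sym (fcyc (suc (toℕ i)))))
          where
          same : cyc h (suc e) ≡ pos (suc (toℕ i))
          same = trans (cong (cyc h) (+-comm 1 e))
            (trans (cyc-cyc (toℕ i + unshift s) 1) (cong (cyc h) (+-comm (toℕ i + unshift s) 1)))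

      arcs : ∀ i → arc D (f (tailC h dir i)) (f (headC h dir i)) ≡ true
      arcs i with dir i | edge i
      ... | true  | e = subst (λ j → arc D (f j) (f (cyc h (suc (toℕ i)))) ≡ true) (sym (cyc-toℕ i)) e
      ... | false | e = subst (λ j → arc D (f (cyc h (suc (toℕ i)))) (f j) ≡ true) (sym (cyc-toℕ i)) e

-- Shift graphs

dropLast : {A : Set} {n : ℕ} → Vec A (suc n) → Vec A n
dropLast (x ∷ [])     = []
dropLast (x ∷ y ∷ ys) = x ∷ dropLast (y ∷ ys)

dropLast-∷ʳ : {A : Set} {n : ℕ} (xs : Vec A n) (x : A) → dropLast (xs ∷ʳ x) ≡ xs
dropLast-∷ʳ []           x = refl
dropLast-∷ʳ (y ∷ [])     x = refl
dropLast-∷ʳ (y ∷ z ∷ xs) x = cong (y ∷_) (dropLast-∷ʳ (z ∷ xs) x)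

-- Indices past the end give the last entry.
at : {A : Set} {n : ℕ} → ℕ → Vec A (suc n) → A
at zero    (x ∷ xs)     = x
at (suc i) (x ∷ [])     = x
at (suc i) (x ∷ y ∷ ys) = at i (y ∷ ys)

at-zero : {A : Set} {n : ℕ} (xs : Vec A (suc n)) → at 0 xs ≡ head xs
at-zero (x ∷ xs) = refl

dropLast-∷ʳ-at : {A : Set} {n : ℕ} (xs : Vec A (suc n)) → dropLast xs ∷ʳ at n xs ≡ xs
dropLast-∷ʳ-at (x ∷ [])     = refl
dropLast-∷ʳ-at (x ∷ y ∷ xs) = cong (x ∷_) (dropLast-∷ʳ-at (y ∷ xs))

at-dropLast : {A : Set} {n : ℕ} (i : ℕ) → i ≤ n → (xs : Vec A (suc (suc n))) → at i (dropLast xs) ≡ at i xs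
at-dropLast zero    _       (x ∷ y ∷ [])     = refl
at-dropLast zero    _       (x ∷ y ∷ z ∷ xs) = refl
at-dropLast (suc i) (s≤s h) (x ∷ y ∷ z ∷ xs) = at-dropLast i h (y ∷ z ∷ xs)

-- The `r`-fold iterated exponential, which bounds the ground set of a shift graph in terms of its
-- number of colours.
tower : ℕ → ℕ → ℕ
tower zero    m = m
tower (suc r) m = tower r (2 ^ m)

tower-mono : ∀ r {m m'} → m ≤ m' → tower r m ≤ tower r m'
tower-mono zero    le = le
tower-mono (suc r) le = tower-mono r (^-monoʳ-≤ 2 le)

module Shift (N : ℕ) where

  incr : {n : ℕ} → Vec (Fin N) n → Bool
  incr []           = true
  incr (x ∷ [])     = true
  incr (x ∷ y ∷ ys) = does (x Fin.<? y) ∧ incr (y ∷ ys)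

  incr-< : {n : ℕ} (a : Fin N) (w : Vec (Fin N) (suc n)) → incr (a ∷ w) ≡ true → ∀ i → toℕ a < toℕ (at i w)
  incr-< a (x ∷ xs)     p zero    = does-true (a Fin.<? x) (proj₁ (∧-true p))
  incr-< a (x ∷ [])     p (suc i) = does-true (a Fin.<? x) (proj₁ (∧-true p))
  incr-< a (x ∷ y ∷ ys) p (suc i) =
    let q , r = ∧-true p in <-trans (does-true (a Fin.<? x) q) (incr-< x (y ∷ ys) r i)

  incr-tail : {n : ℕ} (a : Fin N) (w : Vec (Fin N) n) → incr (a ∷ w) ≡ true → incr w ≡ true
  incr-tail a []       p = refl
  incr-tail a (x ∷ xs) p = proj₂ (∧-true {does (a Fin.<? x)} p)

  incr-∷ : {n : ℕ} (a : Fin N) (w : Vec (Fin N) (suc n)) → toℕ a < toℕ (head w) → incr w ≡ true → incr (a ∷ w) ≡ true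
  incr-∷ a (x ∷ xs) p q = ∧-intro (does-yes (a Fin.<? x) p) q

  Tuple : ℕ → Set
  Tuple r = Vec (Fin N) (suc r)

  _≟ₜ_ : {n : ℕ} (x y : Vec (Fin N) n) → Dec (x ≡ y)
  _≟ₜ_ = Vec.≡-dec Fin._≟_

  -- The longer increasing tuple `head x ∷ y` has `x` as its initial part and `y` as its final part,
  -- as in the usual shift graph.
  shift : {r : ℕ} → Tuple r → Tuple r → Bool
  shift x y = incr x ∧ (incr (head x ∷ y) ∧ does (tail x ≟ₜ dropLast y))

  shift-elim : {r : ℕ} (x y : Tuple r) → shift x y ≡ true →
    incr x ≡ true × incr (head x ∷ y) ≡ true × tail x ≡ dropLast y
  shift-elim x y p =
    let a , bc = ∧-true {incr x} p ; b , c = ∧-true {incr (head x ∷ y)} bc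
    in a , b , does-true (tail x ≟ₜ dropLast y) c

  shift-intro : {r : ℕ} (x y : Tuple r) → incr x ≡ true → incr (head x ∷ y) ≡ true → tail x ≡ dropLast y →
    shift x y ≡ true
  shift-intro x y a b c = ∧-intro a (∧-intro b (does-yes (tail x ≟ₜ dropLast y) c))

  Proper : (r m : ℕ) → (Tuple r → Fin m) → Set
  Proper r m f = ∀ x y → shift x y ≡ true → f x ≢ f y

  -- A tuple is coloured by the set of colours of its extensions, as in the Erdős–Hajnal bound for shift graphs.
  extensions : ∀ r m → (f : Tuple (suc r) → Fin m) → Proper (suc r) m f →
    Σ (Tuple r → Fin (2 ^ m)) (Proper r (2 ^ m))
  extensions r m f proper = g , proof
    where
    ext? : (x : Tuple r) (c : Fin m) → Dec (∃ λ b → incr (x ∷ʳ b) ≡ true × f (x ∷ʳ b) ≡ c)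
    ext? x c = Fin.any? (λ b → (incr (x ∷ʳ b) Bool.≟ true) ×-dec (f (x ∷ʳ b) Fin.≟ c))

    bit : Bool → Fin 2
    bit true  = Fin.zero
    bit false = Fin.suc Fin.zero

    bit-injective : ∀ a b → bit a ≡ bit b → a ≡ b
    bit-injective true  true  _ = refl
    bit-injective false false _ = refl

    set : Tuple r → Fin m → Fin 2
    set x c = bit (does (ext? x c))

    g : Tuple r → Fin (2 ^ m)
    g x = funToFin (set x)

    head-∷ʳ : ∀ {n} (y : Vec (Fin N) (suc n)) b → head (y ∷ʳ b) ≡ head y
    head-∷ʳ (y ∷ ys) b = refl

    proof : Proper r (2 ^ m) g
    proof (a ∷ w) y s e with shift-elim (a ∷ w) y s
    ... | _ , iz , t≡ = refute (does-true (ext? y (f z)) inY)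
      where
      z : Tuple (suc r)
      z = a ∷ y
      x = a ∷ w
      z≡ : x ∷ʳ at r y ≡ z
      z≡ = cong (a ∷_) (trans (cong (_∷ʳ at r y) t≡) (dropLast-∷ʳ-at y))
      inX : does (ext? x (f z)) ≡ true
      inX = does-yes (ext? x (f z)) (at r y , trans (cong incr z≡) iz , cong f z≡)
      inY : does (ext? y (f z)) ≡ true
      inY = trans (sym (bit-injective _ _
              (trans (sym (Fin.finToFun-funToFin (set x) (f z)))
              (trans (cong (λ c → finToFun c (f z)) e) (Fin.finToFun-funToFin (set y) (f z)))))) inX
      -- `z` extends `x`, and if `x` and `y` have equal colour sets, some extension of `y` has the
      -- colour of `z`. But `z` has a shift arc to every increasing extension of `y`.
      refute : (∃ λ b → incr (y ∷ʳ b) ≡ true × f (y ∷ʳ b) ≡ f z) → ⊥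
      refute (b , ib , fb) = proper z (y ∷ʳ b)
        (shift-intro z (y ∷ʳ b) iz
          (incr-∷ a (y ∷ʳ b) (subst (λ h → toℕ a < toℕ h) (sym (head-∷ʳ y b)) (subst (λ h → toℕ a < toℕ h) (at-zero y) (incr-< a y iz 0))) ib)
          (sym (dropLast-∷ʳ y b)))
        (sym fb)

  -- On one-entry tuples the shift graph is a transitive tournament, so a proper colouring is
  -- injective; each further entry costs one exponential.
  chromatic : ∀ r m (f : Tuple r → Fin m) → Proper r m f → N ≤ tower r m
  chromatic zero m f proper = Fin.injective⇒≤ {f = λ a → f (a ∷ [])} inj
    where
    arcs : ∀ a b → toℕ a < toℕ b → f (a ∷ []) ≢ f (b ∷ [])
    arcs a b lt = proper (a ∷ []) (b ∷ []) (shift-intro (a ∷ []) (b ∷ []) refl (incr-∷ a (b ∷ []) lt refl) refl)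
    inj : ∀ {a b} → f (a ∷ []) ≡ f (b ∷ []) → a ≡ b
    inj {a} {b} e with <-cmp (toℕ a) (toℕ b)
    ... | tri< lt _ _ = contradiction e (arcs a b lt)
    ... | tri≈ _ eq _ = Fin.toℕ-injective eq
    ... | tri> _ _ gt = contradiction (sym e) (arcs b a gt)
  chromatic (suc r) m f proper = let g , p = extensions r m f proper in chromatic r (2 ^ m) g p

  hd : ∀ {r} → Tuple r → ℕ
  hd x = toℕ (head x)

  module ShiftWalk {r : ℕ} (x : ℕ → Tuple r) (len : ℕ) (arcs : ∀ i → i < len → shift (x i) (x (suc i)) ≡ true) where

    head<at : ∀ i → i < len → ∀ j → hd (x i) < toℕ (at j (x (suc i)))
    head<at i lt = incr-< (head (x i)) (x (suc i)) (proj₁ (proj₂ (shift-elim (x i) (x (suc i)) (arcs i lt))))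

    -- Each shift arc strictly raises the first entry; this is what makes the shift graph acyclic.
    head-grows : ∀ j → j ≤ len → hd (x 0) + j ≤ hd (x j)
    head-grows zero    _  = ≤-reflexive (+-identityʳ _)
    head-grows (suc j) lt = begin
      hd (x 0) + suc j           ≡⟨ +-suc (hd (x 0)) j ⟩
      suc (hd (x 0) + j)         ≤⟨ s≤s (head-grows j (<⇒≤ lt)) ⟩
      suc (hd (x j))             ≤⟨ head<at j lt 0 ⟩
      toℕ (at 0 (x (suc j)))     ≡⟨ cong toℕ (at-zero (x (suc j))) ⟩
      hd (x (suc j))             ∎
      where
      open ≤-Reasoning

  shift-at : ∀ {r} (x y : Tuple (suc r)) → shift x y ≡ true → ∀ i → i ≤ r → at i y ≡ at (suc i) x
  shift-at (a ∷ b ∷ w) y s i le = trans (sym (at-dropLast i le y))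
    (cong (at i) (sym (proj₂ (proj₂ (shift-elim (a ∷ b ∷ w) y s)))))

  -- Each shift moves the entries one place to the left, so after `r + 1` arcs the last entry of
  -- `x 0` has become the first.
  walk-at : ∀ {r} (x : ℕ → Tuple (suc r)) (j : ℕ) → (∀ i → i < j → shift (x i) (x (suc i)) ≡ true) →
    ∀ i → i + j ≤ suc r → at i (x j) ≡ at (i + j) (x 0)
  walk-at x zero    arcs i le = cong (λ i → at i (x 0)) (sym (+-identityʳ i))
  walk-at {r} x (suc j) arcs i le = trans (shift-at (x j) (x (suc j)) (arcs j ≤-refl) i (≤-pred (≤-trans (s≤s (m≤m+n i j)) le')))
    (trans (walk-at x j (λ i lt → arcs i (m≤n⇒m≤1+n lt)) (suc i) le') (cong (λ i → at i (x 0)) (sym (+-suc i j))))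
    where
    le' = subst (_≤ suc r) (+-suc i j) le

-- Densities of bit vectors, and residues.

vecs : {A : Set} → List A → ∀ n → List (Vec A n)
vecs xs zero    = [] ∷ []
vecs xs (suc n) = cartesianProductWith _∷_ xs (vecs xs n)

∈-vecs : {A : Set} {xs : List A} → (∀ x → x ∈ xs) → ∀ {n} (v : Vec A n) → v ∈ vecs xs n
∈-vecs all []      = here refl
∈-vecs all (x ∷ v) = ∈-cartesianProductWith⁺ _∷_ (all x) (∈-vecs all v)

bits : ∀ n → List (Vec Bool n)
bits = vecs (false ∷ true ∷ [])

count-bits : ∀ n (P : Vec Bool (suc n) → Bool) →
  count P (bits (suc n)) ≡ count (λ ω → P (false ∷ ω)) (bits n) + count (λ ω → P (true ∷ ω)) (bits n)
count-bits n P = trans (count-++ P (map (false ∷_) (bits n)) _)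
  (cong₂ _+_ (count-map P (false ∷_) (bits n))
    (trans (cong (count P) (++-identityʳ (map (true ∷_) (bits n)))) (count-map P (true ∷_) (bits n))))

length-bits : ∀ n → length (bits (suc n)) ≡ 2 * length (bits n)
length-bits n = trans (length-++ (map (false ∷_) (bits n)))
  (cong₂ _+_ (length-map (false ∷_) (bits n))
    (trans (cong length (++-identityʳ (map (true ∷_) (bits n))))
      (trans (length-map (true ∷_) (bits n)) (sym (+-identityʳ _)))))

bits-pos : ∀ n → 1 ≤ length (bits n)
bits-pos zero    = ≤-refl
bits-pos (suc n) = subst (1 ≤_) (sym (length-bits n)) (≤-trans (bits-pos n) (m≤m+n _ _))

-- `v` is used as the identity or as negation, so that one proof covers prescribing either value at
-- coordinate `i`.
half : ∀ {n} (i : Fin n) (v : Bool → Bool) → v true ≡ true ⊎ v false ≡ true →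
  length (bits n) ≤ 2 * count (λ ω → v (Vec.lookup ω i)) (bits n)
half {suc n} Fin.zero v c = subst₂ (λ a b → a ≤ 2 * b) (sym (length-bits n)) (sym (count-bits n (λ ω → v (Vec.lookup ω Fin.zero))))
  (*-monoʳ-≤ 2 (side c))
  where
  full : ∀ b → b ≡ true → length (bits n) ≡ count (λ _ → b) (bits n)
  full _ refl = sym (count-all (bits n))
  side : v true ≡ true ⊎ v false ≡ true →
    length (bits n) ≤ count (λ _ → v false) (bits n) + count (λ _ → v true) (bits n)
  side (inj₁ e) = ≤-trans (≤-reflexive (full (v true) e)) (m≤n+m _ _)
  side (inj₂ e) = ≤-trans (≤-reflexive (full (v false) e)) (m≤m+n _ _)
half {suc n} (Fin.suc i) v c = subst₂ (λ a b → a ≤ 2 * b) (sym (length-bits n)) (sym (count-bits n (λ ω → v (Vec.lookup ω (Fin.suc i)))))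
  (≤-trans (*-monoʳ-≤ 2 (half i v c)) (≤-reflexive (lem (count (λ ω → v (Vec.lookup ω i)) (bits n)))))
  where
  lem : ∀ c → 2 * (2 * c) ≡ 2 * (c + c)
  lem = solve-∀

double : ∀ {l} c {c'} → l ≤ 2 * c → c ≤ c' → 2 * l ≤ 4 * c'
double c p q = ≤-trans (*-monoʳ-≤ 2 p) (≤-trans (≤-reflexive (sym (*-assoc 2 2 c))) (*-monoʳ-≤ 4 q))

-- Peel off coordinates until one of `i` and `j` comes first: that one keeps half of the vectors,
-- and `half` treats the other.
quarter : ∀ {n} (i j : Fin n) → i ≢ j →
  length (bits n) ≤ 4 * count (λ ω → not (Vec.lookup ω i) ∧ Vec.lookup ω j) (bits n)
quarter {suc n} Fin.zero Fin.zero ne = contradiction refl ne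
quarter {suc n} Fin.zero (Fin.suc j) ne =
  subst₂ (λ a b → a ≤ 4 * b) (sym (length-bits n)) (sym (count-bits n (λ ω → not (Vec.lookup ω Fin.zero) ∧ Vec.lookup ω (Fin.suc j))))
  (double (count (λ ω → Vec.lookup ω j) (bits n)) (half j id (inj₁ refl)) (m≤m+n _ (count _ (bits n))))
quarter {suc n} (Fin.suc i) Fin.zero ne =
  subst₂ (λ a b → a ≤ 4 * b) (sym (length-bits n)) (sym (count-bits n (λ ω → not (Vec.lookup ω (Fin.suc i)) ∧ Vec.lookup ω Fin.zero)))
  (double (count (λ ω → not (Vec.lookup ω i)) (bits n)) (half i not (inj₂ refl))
    (≤-trans (count-mono (bits n) {Q = λ ω → not (Vec.lookup ω i) ∧ true} (λ ω p → ∧-intro p refl)) (m≤n+m _ (count _ (bits n)))))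
quarter {suc n} (Fin.suc i) (Fin.suc j) ne =
  subst₂ (λ a b → a ≤ 4 * b) (sym (length-bits n)) (sym (count-bits n (λ ω → not (Vec.lookup ω (Fin.suc i)) ∧ Vec.lookup ω (Fin.suc j))))
  (≤-trans (*-monoʳ-≤ 2 (quarter i j (ne ∘ cong Fin.suc)))
    (≤-reflexive (lem (count (λ ω → not (Vec.lookup ω i) ∧ Vec.lookup ω j) (bits n)))))
  where
  lem : ∀ c → 2 * (4 * c) ≡ 4 * (c + c)
  lem = solve-∀

-- Adding `c * L` undoes the addition of `c`, because `c + c * L` is a multiple of `L + 1`.
%-cancelʳ : ∀ a b c L → (a + c) % suc L ≡ (b + c) % suc L → a % suc L ≡ b % suc L
%-cancelʳ a b c L e = trans (sym (back a)) (trans (trans (%-distribˡ-+ (a + c) (c * L) (suc L))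
  (trans (cong (λ x → (x + (c * L) % suc L) % suc L) e) (sym (%-distribˡ-+ (b + c) (c * L) (suc L))))) (back b))
  where
  back : ∀ a → (a + c + c * L) % suc L ≡ a % suc L
  back a = trans (cong (_% suc L) (lem a c L)) ([m+kn]%n≡m%n a c (suc L))
    where
    lem : ∀ a c L → a + c + c * L ≡ a + c * suc L
    lem = solve-∀

no-return : ∀ l d L → 1 ≤ d → d ≤ L → l ≢ (l + d) % suc L
no-return l d L d≥1 d≤L e = <⇒≢ d≥1 (trans (%-cancelʳ 0 d l L (begin
  -- The assumed equation itself shows that `l` is a reduced residue.
  l % suc L               ≡⟨ m<n⇒m%n≡m (subst (_< suc L) (sym e) (m%n<n (l + d) (suc L))) ⟩
  l                       ≡⟨ e ⟩
  (l + d) % suc L         ≡⟨ cong (_% suc L) (+-comm l d) ⟩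
  (d + l) % suc L         ∎)) (m<n⇒m%n≡m (s≤s d≤L)))
  where open ≡-Reasoning

-- Dense digraphs of large chromatic number without short closed walks or chords.

count-∈ : {A : Set} (P : A → Bool) {xs : List A} {x : A} → x ∈ xs → P x ≡ true → 1 ≤ count P xs
count-∈ P {x ∷ xs} (here refl) p rewrite p = s≤s z≤n
count-∈ P {y ∷ xs} (there i)   p = ≤-trans (count-∈ P i p) (m≤n+m _ ⟦ P y ⟧)

count-concat-replicate : {A : Set} (P : A → Bool) (m : ℕ) (xs : List A) → count P (concat (replicate m xs)) ≡ m * count P xs
count-concat-replicate P zero    xs = refl
count-concat-replicate P (suc m) xs =
  trans (count-++ P xs (concat (replicate m xs))) (cong (count P xs +_) (count-concat-replicate P m xs))

-- The vertices are the positions of the list, so repeated entries become distinct, non-adjacent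
-- vertices with the same neighbours.
module Listed {A : Set} (_⇒_ : A → A → Bool) (irrefl : ∀ a → (a ⇒ a) ≡ false) (xs : List A) where

  digraph : Digraph
  digraph = record
    { n        = length xs
    ; arc      = λ u v → lookup xs u ⇒ lookup xs v
    ; loopless = λ v → irrefl (lookup xs v)
    }

  outdeg≡ : ∀ u → outdeg digraph u ≡ count (lookup xs u ⇒_) xs
  outdeg≡ u = trans (sym (count-map (lookup xs u ⇒_) (lookup xs) (allFin (length xs))))
    (cong (count (lookup xs u ⇒_)) (trans (map-tabulate id (lookup xs)) (tabulate-lookup xs)))

-- Tuples with shift arcs; a cyclic sequence of L + 1 layers of bit vectors, complete from each layer to the next;
-- and arcs from the tuple x to the ω in layer 0 with ω (first x) = false and ω (last x) = true.
module Gadget (r N L : ℕ) (r+2≤L : suc (suc r) ≤ L) where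

  open Shift N

  Tup : Set
  Tup = Tuple (suc r)

  A : Set
  A = Tup ⊎ ℕ × Vec Bool N

  -- Tuples that are not increasing have no shift arcs; they point to all of layer 0 to satisfy the
  -- degree bound.
  separates : Tup → Vec Bool N → Bool
  separates x ω = not (incr x) ∨ (not (Vec.lookup ω (head x)) ∧ Vec.lookup ω (at (suc r) x))

  infix 4 _⇒_
  _⇒_ : A → A → Bool
  inj₁ x       ⇒ inj₁ y       = shift x y
  inj₁ x       ⇒ inj₂ (l , ω) = (l ≡ᵇ 0) ∧ separates x ω
  inj₂ _       ⇒ inj₁ _       = false
  inj₂ (l , _) ⇒ inj₂ (m , _) = m ≡ᵇ suc l % suc L

  ≡ᵇ-true : ∀ {a b} → (a ≡ᵇ b) ≡ true → a ≡ b
  ≡ᵇ-true {a} {b} p = ≡ᵇ⇒≡ a b (subst T (sym p) tt)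

  ≡ᵇ-refl : ∀ a → (a ≡ᵇ a) ≡ true
  ≡ᵇ-refl zero    = refl
  ≡ᵇ-refl (suc a) = ≡ᵇ-refl a

  shift-head< : ∀ (x y : Tup) → shift x y ≡ true → hd x < hd y
  shift-head< x (b ∷ y) s = incr-< (head x) (b ∷ y) (proj₁ (proj₂ (shift-elim x (b ∷ y) s))) 0

  irrefl : ∀ a → (a ⇒ a) ≡ false
  irrefl (inj₁ x) = ≢true⇒false (λ s → <-irrefl refl (shift-head< x x s))
  irrefl (inj₂ (l , ω)) = ≢true⇒false (λ p → no-return l 1 L ≤-refl (≤-trans (s≤s z≤n) r+2≤L)
    (trans (≡ᵇ-true p) (cong (_% suc L) (+-comm 1 l))))

  from-layer : ∀ {l ω b} → (inj₂ (l , ω) ⇒ b) ≡ true → ∃ λ ω' → b ≡ inj₂ (suc l % suc L , ω')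
  from-layer {b = inj₂ (m , ω')} p = ω' , cong (λ m → inj₂ (m , ω')) (≡ᵇ-true p)

  module Walk (w : ℕ → A) (len : ℕ) (arcs : ∀ i → i < len → (w i ⇒ w (suc i)) ≡ true) where

    layers : ∀ {l ω} → w 0 ≡ inj₂ (l , ω) → ∀ i → suc i ≤ len → ∃ λ ω' → w (suc i) ≡ inj₂ ((l + suc i) % suc L , ω')
    layers {l} e zero lt with from-layer (subst (λ a → (a ⇒ w 1) ≡ true) e (arcs 0 lt))
    ... | ω' , q = ω' , trans q (cong (λ x → inj₂ (x % suc L , ω')) (+-comm 1 l))
    layers {l} e (suc i) lt with layers e i (<⇒≤ lt)
    ... | _ , q with from-layer (subst (λ a → (a ⇒ w (suc (suc i))) ≡ true) q (arcs (suc i) lt))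
    ...   | ω' , q' = ω' , trans q' (cong (λ x → inj₂ (x , ω')) step)
      where
      open ≡-Reasoning
      a = l + suc i
      step : suc (a % suc L) % suc L ≡ (l + suc (suc i)) % suc L
      step = begin
        (1 + a % suc L) % suc L                  ≡⟨ %-distribˡ-+ 1 (a % suc L) (suc L) ⟩
        (1 % suc L + a % suc L % suc L) % suc L  ≡⟨ cong (λ x → (1 % suc L + x) % suc L) (m%n%n≡m%n a (suc L)) ⟩
        (1 % suc L + a % suc L) % suc L          ≡⟨ %-distribˡ-+ 1 a (suc L) ⟨
        (1 + a) % suc L                          ≡⟨ cong (_% suc L) (sym (+-suc l (suc i))) ⟩
        (l + suc (suc i)) % suc L                ∎

    -- The layers are entered at layer 0 and each arc raises the layer by at most one.
    layer-bound : ∀ {x} → w 0 ≡ inj₁ x → ∀ i → i ≤ len → ∀ {l ω} → w i ≡ inj₂ (l , ω) → suc l ≤ i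
    layer-bound e zero lt q with trans (sym e) q
    ... | ()
    layer-bound e (suc i) lt {l} {ω} q with w i in eq
    ... | inj₁ x with ≡ᵇ-true {l} (proj₁ (∧-true (subst₂ (λ a b → (a ⇒ b) ≡ true) eq q (arcs i lt))))
    ...   | refl = s≤s z≤n
    layer-bound e (suc i) lt {l} {ω} q | inj₂ (l' , _)
      with ≡ᵇ-true {l} (subst₂ (λ a b → (a ⇒ b) ≡ true) eq q (arcs i lt))
    ...   | refl = s≤s (≤-trans (m%n≤m (suc l') (suc L)) (layer-bound e i (<⇒≤ lt) eq))

  -- No arc leads from the layers back to a tuple, so a walk that ends at a tuple has met tuples
  -- only.
  tuples-before : (w : ℕ → A) (len : ℕ) → (∀ i → i < len → (w i ⇒ w (suc i)) ≡ true) → ∀ {y} → w len ≡ inj₁ y →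
    Σ (ℕ → Tup) λ x → ∀ i → i ≤ len → w i ≡ inj₁ (x i)
  tuples-before w zero arcs {y} e = (λ _ → y) , λ { zero _ → e }
  tuples-before w (suc len) arcs e with tuples-before (w ∘ suc) len (λ i lt → arcs (suc i) (s≤s lt)) e
  ... | x , eqs with w 0 in e₀
  ...   | inj₂ (l , ω) with subst₂ (λ a b → (a ⇒ b) ≡ true) e₀ (eqs 0 z≤n) (arcs 0 (s≤s z≤n))
  ...     | ()
  tuples-before w (suc len) arcs e | x , eqs | inj₁ z = x' , eqs'
    where
    x' : ℕ → Tup
    x' zero    = z
    x' (suc i) = x i
    eqs' : ∀ i → i ≤ suc len → w i ≡ inj₁ (x' i)
    eqs' zero    _        = e₀
    eqs' (suc i) (s≤s le) = eqs i le

  shifts : (w : ℕ → A) (len : ℕ) → (∀ i → i < len → (w i ⇒ w (suc i)) ≡ true) →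
    (x : ℕ → Tup) → (∀ i → i ≤ len → w i ≡ inj₁ (x i)) → ∀ i → i < len → shift (x i) (x (suc i)) ≡ true
  shifts w len arcs x eqs i lt = subst₂ (λ a b → (a ⇒ b) ≡ true) (eqs i (<⇒≤ lt)) (eqs (suc i) lt) (arcs i lt)

  -- In the layers a return takes a multiple of `L + 1` arcs; among the tuples the first entries
  -- increase.
  no-closed-walk : ∀ k → 1 ≤ k → k ≤ L → (w : ℕ → A) → (∀ i → i < k → (w i ⇒ w (suc i)) ≡ true) → w k ≢ w 0
  no-closed-walk (suc k) _ k≤L w arcs closed with w 0 in e₀
  ... | inj₂ (l , ω) with Walk.layers w (suc k) arcs e₀ k ≤-refl
  ...   | ω' , q = no-return l (suc k) L (s≤s z≤n) k≤L (cong proj₁ (inj₂-injective (trans (sym closed) q)))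
  no-closed-walk (suc k) _ k≤L w arcs closed | inj₁ y with tuples-before w (suc k) arcs closed
  ...   | x , eqs = <-irrefl refl (begin-strict
    hd (x 0)             <⟨ m<m+n (hd (x 0)) (s≤s z≤n) ⟩
    hd (x 0) + suc k     ≤⟨ ShiftWalk.head-grows x (suc k) (shifts w (suc k) arcs x eqs) (suc k) ≤-refl ⟩
    hd (x (suc k))       ≡⟨ cong hd (inj₁-injective (trans (sym (eqs (suc k) ≤-refl)) (trans (trans closed (sym e₀)) (eqs 0 z≤n)))) ⟩
    hd (x 0)             ∎)
    where open ≤-Reasoning

  -- The length `r + 2` is one more than the number of shifts that bring the last entry of a tuple
  -- to the front.
  no-chord : (w : ℕ → A) → (∀ i → i < suc (suc r) → (w i ⇒ w (suc i)) ≡ true) → (w 0 ⇒ w (suc (suc r))) ≢ true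
  no-chord w arcs chord with w 0 in e₀ | w (suc (suc r)) in e₁
  -- From layer `l` the chord leads to layer `l + 1` and the walk to layer `l + r + 2`, which differ
  -- modulo `L + 1`.
  ... | inj₂ (l , ω) | b with from-layer chord | Walk.layers w (suc (suc r)) arcs e₀ (suc r) ≤-refl
  ...   | _ , p | _ , q = <⇒≢ (s≤s (s≤s z≤n)) (trans (sym (m<n⇒m%n≡m 1<)) (trans (%-cancelʳ 1 (suc (suc r)) l L layer≡) (m<n⇒m%n≡m (s≤s r+2≤L))))
    where
    1< : 1 < suc L
    1< = s≤s (≤-trans (s≤s z≤n) r+2≤L)
    layer≡ : suc l % suc L ≡ (suc (suc r) + l) % suc L
    layer≡ = trans (cong proj₁ (inj₂-injective (trans (sym p) (trans (sym e₁) q)))) (cong (_% suc L) (+-comm l (suc (suc r))))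
  -- Chord and first arc make the second entry of `x 0` the head of both the last tuple and `x 1`,
  -- but heads increase along the walk.
  no-chord w arcs chord | inj₁ x₀ | inj₁ y with tuples-before w (suc (suc r)) arcs e₁
  ... | x , eqs = <-irrefl refl (begin-strict
    hd (x 1)                     <⟨ m<m+n (hd (x 1)) (s≤s z≤n) ⟩
    hd (x 1) + suc r             ≤⟨ ShiftWalk.head-grows (x ∘ suc) (suc r) (λ i lt → sh (suc i) (s≤s lt)) (suc r) ≤-refl ⟩
    hd (x (suc (suc r)))         ≡⟨ cong toℕ (trans (sym (at-zero (x (suc (suc r))))) (trans (shift-at (x 0) (x (suc (suc r))) chord' 0 z≤n)
                                      (trans (sym (shift-at (x 0) (x 1) (sh 0 (s≤s z≤n)) 0 z≤n)) (at-zero (x 1))))) ⟩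
    hd (x 1)                     ∎)
    where
    open ≤-Reasoning
    sh = shifts w (suc (suc r)) arcs x eqs
    chord' : shift (x 0) (x (suc (suc r))) ≡ true
    chord' = subst₂ (λ a b → shift a b ≡ true) (inj₁-injective (trans (sym e₀) (eqs 0 z≤n)))
      (inj₁-injective (trans (sym e₁) (eqs (suc (suc r)) ≤-refl))) chord
  no-chord w arcs chord | inj₁ x₀ | inj₂ (l , ω) with w (suc r) in e₂
  -- The chord ends in layer 0, whereas the last arc leaves a layer `l'` with `l' ≤ r` and so enters
  -- layer `l' + 1`.
  ... | inj₂ (l' , ω') = <⇒≢ (s≤s z≤n) (trans (sym l≡0) (trans l≡ (m<n⇒m%n≡m small)))
    where
    l≡0 : l ≡ 0
    l≡0 = ≡ᵇ-true {l} (proj₁ (∧-true chord))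
    l≡ : l ≡ suc l' % suc L
    l≡ = ≡ᵇ-true {l} (subst₂ (λ a b → (a ⇒ b) ≡ true) e₂ e₁ (arcs (suc r) ≤-refl))
    small : suc l' < suc L
    small = s≤s (≤-trans (Walk.layer-bound w (suc (suc r)) arcs e₀ (suc r) (n≤1+n _) e₂) (≤-trans (n≤1+n _) r+2≤L))
  -- The head of `x (suc r)` is the last entry of `x 0`: at this coordinate the chord requires `ω`
  -- to be true, the last arc false.
  ... | inj₁ y with tuples-before w (suc r) (λ i lt → arcs i (m≤n⇒m≤1+n lt)) e₂
  ...   | x , eqs = true≢false sep₁ sep₂
    where
    sh = shifts w (suc r) (λ i lt → arcs i (m≤n⇒m≤1+n lt)) x eqs
    x₀≡ : x₀ ≡ x 0
    x₀≡ = inj₁-injective (trans (sym e₀) (eqs 0 z≤n))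
    y≡ : y ≡ x (suc r)
    y≡ = inj₁-injective (trans (sym e₂) (eqs (suc r) ≤-refl))
    sep : ∀ x → incr x ≡ true → separates x ω ≡ true → not (Vec.lookup ω (head x)) ∧ Vec.lookup ω (at (suc r) x) ≡ true
    sep x i s rewrite i = s
    inc₀ : incr (x 0) ≡ true
    inc₀ = proj₁ (shift-elim (x 0) (x 1) (sh 0 (s≤s z≤n)))
    inc : incr (x (suc r)) ≡ true
    inc = incr-tail (head (x r)) (x (suc r)) (proj₁ (proj₂ (shift-elim (x r) (x (suc r)) (sh r ≤-refl))))
    sep₁ : Vec.lookup ω (at (suc r) (x 0)) ≡ true
    sep₁ = proj₂ (∧-true {not (Vec.lookup ω (head (x 0)))} (sep (x 0) inc₀ (subst (λ x → separates x ω ≡ true) x₀≡ (proj₂ (∧-true {l ≡ᵇ 0} chord)))))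
    arc₂ : (inj₁ y ⇒ inj₂ (l , ω)) ≡ true
    arc₂ = subst₂ (λ a b → (a ⇒ b) ≡ true) e₂ e₁ (arcs (suc r) ≤-refl)
    sep₂ : Vec.lookup ω (at (suc r) (x 0)) ≡ false
    sep₂ = trans (cong (Vec.lookup ω) (trans (sym (walk-at x (suc r) sh 0 ≤-refl)) (at-zero (x (suc r)))))
      (not-true (proj₁ (∧-true (sep (x (suc r)) inc (subst (λ x → separates x ω ≡ true) y≡ (proj₂ (∧-true {l ≡ᵇ 0} arc₂)))))))

  tuples : List Tup
  tuples = vecs (allFin N) (suc (suc r))

  block : List (ℕ × Vec Bool N)
  block = cartesianProduct (upTo (suc L)) (bits N)

  -- The layers are repeated so often that the tuples become a negligible part.
  vertices : List A
  vertices = map inj₁ tuples ++ map inj₂ (concat (replicate (length tuples) block))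

  open Listed _⇒_ irrefl vertices public

  M W : ℕ
  M = length tuples
  W = length (bits N)

  count-vertices : ∀ (P : A → Bool) → count P vertices ≡ count (P ∘ inj₁) tuples + M * count (P ∘ inj₂) block
  count-vertices P = trans (count-++ P (map inj₁ tuples) _) (cong₂ _+_ (count-map P inj₁ tuples)
    (trans (count-map P inj₂ (concat (replicate M block))) (count-concat-replicate (P ∘ inj₂) M block)))

  order : length vertices ≡ M + M * (suc L * W)
  order = trans (sym (count-all vertices)) (trans (count-vertices (λ _ → true)) (cong₂ (λ a b → a + M * b) (count-all tuples)
    (trans (count-product (λ _ → true) (λ _ → true) (upTo (suc L)) (bits N))
      (cong₂ _*_ (trans (count-all (upTo (suc L))) (length-upTo (suc L))) (count-all (bits N))))))

  -- Each layer has `M * W` vertices, at least as many as there are tuples, so a layer is a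
  -- proportion `1 / (L + 2)` of all vertices; `Q` keeps a quarter of it.
  layer-count : ∀ l₀ → l₀ < suc L → (Q : Vec Bool N → Bool) → W ≤ 4 * count Q (bits N) →
    ∀ (P : A → Bool) → (∀ l ω → (l ≡ᵇ l₀) ∧ Q ω ≡ true → P (inj₂ (l , ω)) ≡ true) →
    length vertices ≤ 4 * suc (suc L) * count P vertices
  layer-count l₀ lt Q big P h = begin
    length vertices                          ≡⟨ order ⟩
    M + M * (suc L * W)                      ≤⟨ +-monoˡ-≤ _ (≤-trans (≤-reflexive (sym (*-identityʳ M))) (*-monoʳ-≤ M (bits-pos N))) ⟩
    M * W + M * (suc L * W)                  ≡⟨ lem₁ M W (suc L) ⟩
    suc (suc L) * (M * W)                    ≤⟨ *-monoʳ-≤ (suc (suc L)) (*-monoʳ-≤ M big) ⟩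
    suc (suc L) * (M * (4 * count Q (bits N))) ≡⟨ lem₂ (suc (suc L)) M (count Q (bits N)) ⟩
    4 * suc (suc L) * (M * count Q (bits N)) ≤⟨ *-monoʳ-≤ (4 * suc (suc L)) (≤-trans (*-monoʳ-≤ M one) (≤-trans (m≤n+m _ (count (P ∘ inj₁) tuples)) (≤-reflexive (sym (count-vertices P))))) ⟩
    4 * suc (suc L) * count P vertices       ∎
    where
    open ≤-Reasoning
    lem₁ : ∀ M W L → M * W + M * (L * W) ≡ suc L * (M * W)
    lem₁ = solve-∀
    lem₂ : ∀ a M c → a * (M * (4 * c)) ≡ 4 * a * (M * c)
    lem₂ = solve-∀
    one : count Q (bits N) ≤ count (P ∘ inj₂) block
    one = begin
      count Q (bits N)                                             ≡⟨ *-identityˡ _ ⟨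
      1 * count Q (bits N)                                         ≤⟨ *-monoˡ-≤ (count Q (bits N)) (count-∈ (_≡ᵇ l₀) (∈-upTo⁺ lt) (≡ᵇ-refl l₀)) ⟩
      count (_≡ᵇ l₀) (upTo (suc L)) * count Q (bits N)             ≡⟨ count-product (_≡ᵇ l₀) Q (upTo (suc L)) (bits N) ⟨
      count (λ (l , ω) → (l ≡ᵇ l₀) ∧ Q ω) block                    ≤⟨ count-mono block (λ (l , ω) → h l ω) ⟩
      count (P ∘ inj₂) block                                       ∎

  large-outdegree : ∀ u → length vertices ≤ 4 * suc (suc L) * outdeg digraph u
  large-outdegree u = subst (λ d → length vertices ≤ 4 * suc (suc L) * d) (sym (outdeg≡ u)) (go (lookup vertices u))
    where
    all-bits : W ≤ 4 * count (λ _ → true) (bits N)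
    all-bits = ≤-trans (≤-reflexive (sym (count-all (bits N)))) (m≤m+n _ _)
    go : ∀ a → length vertices ≤ 4 * suc (suc L) * count (a ⇒_) vertices
    go (inj₂ (l , _)) = layer-count (suc l % suc L) (m%n<n (suc l) (suc L)) (λ _ → true) all-bits _ (λ m ω p → proj₁ (∧-true p))
    go (inj₁ x) = layer-count 0 (s≤s z≤n) (separates x) (dense x) _ (λ l ω p → p)
      where
      dense : ∀ (x : Tup) → W ≤ 4 * count (separates x) (bits N)
      dense (a ∷ w) with incr (a ∷ w) in eq
      ... | false = all-bits
      ... | true  = quarter a (at (suc r) (a ∷ w)) (λ e → <⇒≢ (first<last w eq) (cong toℕ e))
        where
        first<last : ∀ (w : Vec (Fin N) (suc r)) → incr (a ∷ w) ≡ true → toℕ a < toℕ (at (suc r) (a ∷ w))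
        first<last (b ∷ w) eq = incr-< a (b ∷ w) eq r

  colouring-bound : ∀ m → Colourable digraph m → N ≤ tower (suc r) m
  colouring-bound m (f , proper) = chromatic (suc r) m (λ x → f (index (mem x)))
    (λ x y s → proper (index (mem x)) (index (mem y)) (subst₂ (λ a b → (a ⇒ b) ≡ true) (lookup-index (mem x)) (lookup-index (mem y)) s))
    where
    mem : ∀ (x : Tup) → inj₁ x ∈ vertices
    mem x = ∈-++⁺ˡ (∈-map⁺ inj₁ (∈-vecs ∈-allFin x))

-- Rational bounds

natural : ∀ a → toℚᵘ (ℤ.+ a ℚ./ 1) ℚᵘ.≃ mkℚᵘ (ℤ.+ a) 0
natural a = ℚ.toℚᵘ-fromℚᵘ (mkℚᵘ (ℤ.+ a) 0)

scaled : ∀ ε a → toℚᵘ (ε ℚ.* (ℤ.+ a ℚ./ 1)) ℚᵘ.≃ toℚᵘ ε ℚᵘ.* mkℚᵘ (ℤ.+ a) 0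
scaled ε a = ℚᵘ.≃-trans (ℚ.toℚᵘ-homo-* ε (ℤ.+ a ℚ./ 1)) (ℚᵘ.*-congˡ {toℚᵘ ε} (natural a))

-- `q` is the denominator of `ε`: the numerator is positive, so `1 / q` is at most `ε`.
ε*n≤d⇒n≤q*d : ∀ ε → 0ℚ ℚ.< ε → ∃ λ q → ∀ a d → ε ℚ.* (ℤ.+ a ℚ./ 1) ℚ.≤ ℤ.+ d ℚ./ 1 → a ≤ q * d
ε*n≤d⇒n≤q*d ε@(mkℚ (ℤ.+ zero) _ _) lt = ⊥-elim (ℚ.<⇒≢ lt (sym (ℚ.↥p≡0⇒p≡0 ε refl)))
ε*n≤d⇒n≤q*d ε@(mkℚ ℤ.-[1+ _ ] _ _) lt with ℚ.drop-*<* lt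
... | ()
ε*n≤d⇒n≤q*d ε@(mkℚ ℤ.+[1+ p ] e _) lt = suc e , bound
  where
  bound : ∀ a d → ε ℚ.* (ℤ.+ a ℚ./ 1) ℚ.≤ ℤ.+ d ℚ./ 1 → a ≤ suc e * d
  bound a d le with ℚᵘ.≤-respʳ-≃ (natural d) (ℚᵘ.≤-respˡ-≃ (scaled ε a) (ℚ.toℚᵘ-mono-≤ le))
  ... | ℚᵘ.*≤* le' = begin
    a                    ≤⟨ m≤m+n a (p * a) ⟩
    suc p * a            ≤⟨ ℤ.drop‿+≤+ (subst₂ ℤ._≤_ l r le') ⟩
    d * (suc e * 1)      ≡⟨ cong (d *_) (*-identityʳ (suc e)) ⟩
    d * suc e            ≡⟨ *-comm d (suc e) ⟩
    suc e * d            ∎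
    where
    open ≤-Reasoning
    l : ℤ.+[1+ p ] ℤ.* ℤ.+ a ℤ.* ℤ.+ 1 ≡ ℤ.+ (suc p * a)
    l = trans (ℤ.*-identityʳ (ℤ.+[1+ p ] ℤ.* ℤ.+ a)) (sym (ℤ.pos-* (suc p) a))
    r : ℤ.+ d ℤ.* ℤ.+ (suc e * 1) ≡ ℤ.+ (d * (suc e * 1))
    r = sym (ℤ.pos-* d (suc e * 1))

abstract

  1/ : ℕ → ℚ
  1/ q = ℤ.+ 1 ℚ./ suc q

  1/-pos : ∀ q → 0ℚ ℚ.< 1/ q
  1/-pos q = ℚ.toℚᵘ-cancel-< (ℚᵘ.<-respʳ-≃ (ℚᵘ.≃-sym (ℚ.toℚᵘ-fromℚᵘ (mkℚᵘ (ℤ.+ 1) q))) (ℚᵘ.*<* (ℤ.+<+ (s≤s z≤n))))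

  n≤q*d⇒ε*n≤d : ∀ q a d → a ≤ suc q * d → 1/ q ℚ.* (ℤ.+ a ℚ./ 1) ℚ.≤ ℤ.+ d ℚ./ 1
  n≤q*d⇒ε*n≤d q a d le = ℚ.toℚᵘ-cancel-≤ (ℚᵘ.≤-respʳ-≃ (ℚᵘ.≃-sym (natural d)) (ℚᵘ.≤-respˡ-≃ (ℚᵘ.≃-sym (ℚᵘ.≃-trans (scaled (1/ q) a)
    (ℚᵘ.*-congʳ {mkℚᵘ (ℤ.+ a) 0} (ℚ.toℚᵘ-fromℚᵘ (mkℚᵘ (ℤ.+ 1) q)))))
    (ℚᵘ.*≤* (subst₂ ℤ._≤_ (sym l) (sym r) (ℤ.+≤+ le')))))
    where
    l : ℤ.+ 1 ℤ.* ℤ.+ a ℤ.* ℤ.+ 1 ≡ ℤ.+ a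
    l = trans (ℤ.*-identityʳ (ℤ.+ 1 ℤ.* ℤ.+ a)) (ℤ.*-identityˡ (ℤ.+ a))
    r : ℤ.+ d ℤ.* ℤ.+ (suc q * 1) ≡ ℤ.+ (d * (suc q * 1))
    r = sym (ℤ.pos-* d (suc q * 1))
    le' : a ≤ d * (suc q * 1)
    le' = ≤-trans le (≤-reflexive (trans (*-comm (suc q) d) (cong (d *_) (sym (*-identityʳ (suc q))))))

-- Both directions for a fixed orientation.

module Main (m : ℕ) (dir : Fin (suc (suc m)) → Bool) where

  open Cyclic m
  open Orientation dir
  open CyclicPatterns m

  Forced : Set
  Forced = (ε : ℚ) → 0ℚ ℚ.< ε → Σ ℕ λ c → 1 ≤ c ×
    ((D : Digraph) → ChromaticAtLeast D c → MinOutDegAtLeast ε D → Contains D h dir)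

  LongBlocks : Set
  LongBlocks = ∀ s L → BlockOfLength h dir s L → 2 ≤ L

  avoids : ∀ r L (r+2≤L : suc (suc r) ≤ L) → (∀ N → ¬ Contains (Gadget.digraph r N L r+2≤L) h dir) → ¬ Forced
  avoids r L r+2≤L free forced with forced (1/ q) (1/-pos q)
    where
    -- Chosen so that `suc q` is `4 * (L + 2)`, the degree ratio of the constructed digraph.
    q : ℕ
    q = suc L + 3 * suc (suc L)
  ... | c , _ , contains = free N (contains digraph chromatic outdegrees)
    where
    -- A colouring with fewer than `c` colours would bound `N` by `tower (suc r) c`.
    N = suc (tower (suc r) c)
    open Gadget r N L r+2≤L
    chromatic : ChromaticAtLeast digraph c
    chromatic m col = ≮⇒≥ λ m<c → <-irrefl refl (≤-trans (colouring-bound m col) (tower-mono (suc r) (<⇒≤ m<c)))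
    outdegrees : MinOutDegAtLeast (1/ (suc L + 3 * suc (suc L))) digraph
    outdegrees u = n≤q*d⇒ε*n≤d (suc L + 3 * suc (suc L)) (length vertices) (outdeg digraph u) (large-outdegree u)

  -- With at most one start `C` is a directed cycle, and more than `k` layers exclude closed walks
  -- of length `k`.
  few-starts⇒¬forced : numStarts h dir ≤ 1 → ¬ Forced
  few-starts⇒¬forced few = avoids 0 (suc k) (s≤s (s≤s z≤n)) λ N c →
    let open Gadget 0 N (suc k) (s≤s (s≤s z≤n))
        w , arcs , closed = constant⇒closedWalk {D = digraph} (few-starts⇒constant few) c
    in no-closed-walk k (s≤s z≤n) (n≤1+n k) (lookup vertices ∘ w) arcs (cong (lookup vertices) closed)

  -- The parameter `r` is chosen so that the long block, with `k - 1 = r + 2` arcs, has the length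
  -- treated by `no-chord`.
  shortBlock⇒¬forced : ∀ r → m ≡ suc r → numStarts h dir ≡ 2 → ShortBlock → ¬ Forced
  shortBlock⇒¬forced r refl two sb = avoids r k (n≤1+n _) λ N c →
    let open Gadget r N k (n≤1+n _)
        w , arcs , chord = shortBlock⇒chord {D = digraph} two sb c
    in no-chord (lookup vertices ∘ w) arcs chord

  all-colours : (D : Digraph) → Colourable D (n D)
  all-colours D = id , λ u v p e → true≢false (subst (λ w → arc D u w ≡ true) (sym e) p) (loopless D u)

  Col⇒Colourable : ∀ D {c} → Col (arc D) (λ _ → true) c → Colourable D c
  Col⇒Colourable D (f , proper) = f , λ u v → proper u v refl refl

  -- Digraphs on few vertices have few colours, so the counting arguments may assume many vertices.
  force : ∀ (colours bound : ℕ → ℕ) →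
    (∀ q D → (∀ u → n D ≤ q * outdeg D u) → 1 ≤ n D → bound q < n D →
      Contains D h dir ⊎ Col (arc D) (λ _ → true) (colours q)) → Forced
  force colours bound step ε ε>0 with ε*n≤d⇒n≤q*d ε ε>0
  ... | q , scale = suc (colours q + bound q) , s≤s z≤n , find
    where
    find : (D : Digraph) → ChromaticAtLeast D (suc (colours q + bound q)) → MinOutDegAtLeast ε D → Contains D h dir
    find D chrom deg with bound q <? n D
    ... | no small = contradiction (chrom (n D) (all-colours D)) (<⇒≱ (s≤s (≤-trans (≮⇒≥ small) (m≤n+m (bound q) (colours q)))))
    ... | yes large with step q D (λ u → scale (n D) (outdeg D u) (deg u)) (≤-trans (s≤s z≤n) large) large
    ...   | inj₁ c   = c
    ...   | inj₂ col = contradiction (chrom (colours q) (Col⇒Colourable D col)) (<⇒≱ (s≤s (m≤m+n (colours q) (bound q))))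

  long-blocks⇒forced : 1 ≤ numStarts h dir → LongBlocks → Forced
  long-blocks⇒forced starts long with long-blocks⇒ttff starts long
  ... | s , ℓ , k≡ , g₀ , g₁ , g₂ , g₃ = force
    (λ q → steps (q * q) * suc (pathColours ℓ) + 1)
    (λ q → threshold (q * q) * (4 + ℓ))
    λ q D dense n≥1 large → Sum.map₁ (cycle⇒contains D dir s k≡)
      (ttff-cycle (arc D) (loopless D) q dense n≥1 ℓ (λ j → g (s + j)) g₀ g₁ g₂ g₃ large)

  two-descents⇒forced : ∀ s ℓ₁ ℓ₂ → k ≡ 4 + (ℓ₁ + ℓ₂) →
    g (s + (ℓ₁ + 0)) ≡ true → g (s + (ℓ₁ + 1)) ≡ false →
    g (s + (ℓ₁ + (2 + (ℓ₂ + 0)))) ≡ true → g (s + (ℓ₁ + (2 + (ℓ₂ + 1)))) ≡ false → Forced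
  two-descents⇒forced s ℓ₁ ℓ₂ k≡ g₀ g₁ g₂ g₃ = force
    (λ q → steps (threshold q * threshold q) * (suc ℓ₂ + pathColours ℓ₁) + (steps q * pathColours ℓ₂ + 1))
    (λ q → threshold (threshold q * threshold q) * (4 + (ℓ₁ + ℓ₂)))
    λ q D dense n≥1 large → Sum.map₁ (cycle⇒contains D dir s k≡)
      (two-descents-cycle (arc D) (loopless D) q dense n≥1 ℓ₁ ℓ₂ (λ j → g (s + j)) g₀ g₁ g₂ g₃ large)

  many-blocks⇒forced : 3 ≤ numStarts h dir → Forced
  many-blocks⇒forced starts = go (many-blocks⇒two-descents dir starts)
    where
    go : TwoDescents dir → Forced
    go (s , ℓ₁ , ℓ₂ , k≡ , g₀ , g₁ , g₂ , g₃) = two-descents⇒forced s ℓ₁ ℓ₂ k≡ g₀ g₁ g₂ g₃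

-- The number of blocks differs from the number of starts only for a directed cycle, with no start
-- and one block.
numBlocks≡ : ∀ {k} (h : 2 ≤ k) (dir : Fin k → Bool) → numBlocks h dir ≡ suc (pred (numStarts h dir))
numBlocks≡ h dir with numStarts h dir
... | zero  = refl
... | suc x = refl

-- For `k = 2` the two edges join the same vertices, so opposite values of `dir` would give the same
-- arc twice.
two-cycle : (dir : Fin 2 → Bool) → NoParallelArcs (s≤s (s≤s z≤n)) dir → dir Fin.zero ≡ dir (Fin.suc Fin.zero)
two-cycle dir simple with dir Fin.zero in e₀ | dir (Fin.suc Fin.zero) in e₁
... | true  | true  = refl
... | false | false = refl
... | true  | false with simple Fin.zero (Fin.suc Fin.zero) t s
  where
  t : tailC (s≤s (s≤s z≤n)) dir Fin.zero ≡ tailC (s≤s (s≤s z≤n)) dir (Fin.suc Fin.zero)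
  t rewrite e₀ | e₁ = refl
  s : headC (s≤s (s≤s z≤n)) dir Fin.zero ≡ headC (s≤s (s≤s z≤n)) dir (Fin.suc Fin.zero)
  s rewrite e₀ | e₁ = refl
... | ()
two-cycle dir simple | false | true with simple Fin.zero (Fin.suc Fin.zero) t s
  where
  t : tailC (s≤s (s≤s z≤n)) dir Fin.zero ≡ tailC (s≤s (s≤s z≤n)) dir (Fin.suc Fin.zero)
  t rewrite e₀ | e₁ = refl
  s : headC (s≤s (s≤s z≤n)) dir Fin.zero ≡ headC (s≤s (s≤s z≤n)) dir (Fin.suc Fin.zero)
  s rewrite e₀ | e₁ = refl
... | ()

two-cycle-block : (dir : Fin 2 → Bool) → dir Fin.zero ≡ dir (Fin.suc Fin.zero) → ¬ (∃ λ s → BlockStart (s≤s (s≤s z≤n)) dir s)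
two-cycle-block dir e (Fin.zero         , start) = start (sym e)
two-cycle-block dir e (Fin.suc Fin.zero , start) = start e

theorem1p3 : (k : ℕ) → (h : 2 ≤ k) → (dir : Fin k → Bool) → NoParallelArcs h dir →
    ((ε : ℚ) → 0ℚ ℚ.< ε → Σ ℕ λ c → 1 ≤ c ×
    ((D : Digraph) → ChromaticAtLeast D c → MinOutDegAtLeast ε D → Contains D h dir))
    ⇔ (3 ≤ numBlocks h dir ⊎
    (numBlocks h dir ≡ 2 × (∀ s L → BlockOfLength h dir s L → 2 ≤ L)))
theorem1p3 (suc (suc m)) (s≤s (s≤s z≤n)) dir simple = mk⇔ necessary sufficient
  where
  open Main m dir
  open Cyclic m
  open Orientation dir

  necessary : Forced → 3 ≤ numBlocks h dir ⊎ (numBlocks h dir ≡ 2 × LongBlocks)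
  necessary forced = go (numStarts h dir) refl
    where
    long : numStarts h dir ≡ 2 → ∀ m' → m ≡ m' → LongBlocks
    long eq m'      _    s (suc (suc L)) _       = s≤s (s≤s z≤n)
    long eq m'      _    s zero          (_ , () , _)
    -- For `k = 2` the orientation is a directed 2-cycle, which has no block start at all.
    long eq zero    refl s (suc zero)    (b , _) = contradiction (s , b) (two-cycle-block dir (two-cycle dir simple))
    long eq (suc r) e    s (suc zero)    b       = contradiction forced (shortBlock⇒¬forced r e eq (s , b))

    go : ∀ x → numStarts h dir ≡ x → 3 ≤ numBlocks h dir ⊎ (numBlocks h dir ≡ 2 × LongBlocks)
    go zero                eq = contradiction forced (few-starts⇒¬forced (subst (_≤ 1) (sym eq) z≤n))
    go (suc zero)          eq = contradiction forced (few-starts⇒¬forced (≤-reflexive eq))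
    go (suc (suc zero))    eq = inj₂ (trans (numBlocks≡ h dir) (cong (suc ∘ pred) eq) , long eq m refl)
    go (suc (suc (suc x))) eq = inj₁ (subst (3 ≤_) (sym (trans (numBlocks≡ h dir) (cong (suc ∘ pred) eq))) (s≤s (s≤s (s≤s z≤n))))

  two⇒starts : ∀ {x} → 2 ≤ suc (pred x) → suc (pred x) ≡ x
  two⇒starts {zero}  (s≤s ())
  two⇒starts {suc x} _ = refl

  starts≡ : 2 ≤ numBlocks h dir → numBlocks h dir ≡ numStarts h dir
  starts≡ le = trans (numBlocks≡ h dir) (two⇒starts (subst (2 ≤_) (numBlocks≡ h dir) le))

  sufficient : 3 ≤ numBlocks h dir ⊎ (numBlocks h dir ≡ 2 × LongBlocks) → Forced
  sufficient (inj₁ three)        = many-blocks⇒forced (subst (3 ≤_) (starts≡ (≤-trans (n≤1+n 2) three)) three)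
  sufficient (inj₂ (two , long)) = long-blocks⇒forced
    (subst (1 ≤_) (trans (sym two) (starts≡ (≤-reflexive (sym two)))) (s≤s z≤n)) long
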